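{- If $G$ is a tree with vertex cover number $\tau(G)$, then $\mathcal{E}(G)\geq 2\tau(G)$. Equality occurs if and only if $G$ is an edge (that is, $G\cong K_2$).
   Context: All graphs are finite, simple and undirected. The energy $\mathcal{E}(G)$ is the sum of the absolute values of all eigenvalues (with multiplicity) of the adjacency matrix $A(G)$. The vertex cover number $\tau(G)$ is the minimum cardinality of a set $X\subseteq V(G)$ such that every edge of $G$ has at least one endpoint in $X$. $K_2$ is the complete graph on 2 vertices.
   Formalization: The equality characterization is stated only for trees with at least 2 vertices, since the one-vertex tree has energy 0 = 2τ but is not an edge; the inequality is stated for every tree. -}

module Defs where

open import Algebra.Bundles.Raw using (RawRing)
import Algebra.Definitions.RawMonoid as RawMonoidDefs
open import Data.Bool.Base using (if_then_else_)
open import Data.Fin.Base using (Fin; zero; suc; punchIn; toℕ)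
import Data.Fin.Properties as Fin
open import Data.Fin.Subset using (Subset; _∈_; ∣_∣)
open import Data.Integer.Base using (+_)
open import Data.List.Base using (List; _∷_; _∷ʳ_; length)
open import Data.List.Relation.Unary.Linked using (Linked)
open import Data.List.Relation.Unary.Unique.Propositional using (Unique)
open import Data.Nat.Base as ℕ using (ℕ; zero; suc; _⊔_)
import Data.Nat.Properties as ℕ
open import Data.Product.Base using (∃; ∃-syntax; _×_; _,_)
open import Data.Rational.Base as ℚ
  using (ℚ; 0ℚ; 1ℚ; ½; Positive; NonNegative; positive; nonNegative)
import Data.Rational.Properties as ℚ
open import Data.Rational.Solver using (module +-*-Solver)
open import Data.Sum.Base using (_⊎_; inj₁; inj₂)
open import Data.Vec.Functional using (Vector)
open import Function.Bundles using (_↔_; _⇔_; Inverse)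
open import Level using (0ℓ)
open import Relation.Binary.Construct.Closure.ReflexiveTransitive using (Star)
open import Relation.Binary.Core using (Rel)
open import Relation.Binary.Definitions using (Decidable; Symmetric; Irreflexive)
open import Relation.Binary.PropositionalEquality
  using (_≡_; _≢_; refl; sym; trans; cong; subst; ≢-sym)
open import Relation.Nullary.Decidable.Core using (does)
import Relation.Nullary.Decidable as Dec
open import Relation.Nullary.Negation.Core using (¬_)

------------------------------------------------------------------------
-- Real numbers, as Cauchy sequences of rationals

IsCauchy : (ℕ → ℚ) → Set
IsCauchy s = ∀ ε → 0ℚ ℚ.< ε →
  ∃[ N ] (∀ m n → N ℕ.≤ m → N ℕ.≤ n → ℚ.∣ s m ℚ.- s n ∣ ℚ.≤ ε)

record ℝ : Set where
  constructor mkℝ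
  field
    seq    : ℕ → ℚ
    cauchy : IsCauchy seq

open ℝ public

infix 4 _≈_ _≤_

record _≈_ (x y : ℝ) : Set where
  constructor mk≈
  field
    close : ∀ ε → 0ℚ ℚ.< ε →
      ∃[ N ] (∀ n → N ℕ.≤ n → ℚ.∣ seq x n ℚ.- seq y n ∣ ℚ.≤ ε)

open _≈_ public

record _≤_ (x y : ℝ) : Set where
  constructor mk≤
  field
    below : ∀ ε → 0ℚ ℚ.< ε →
      ∃[ N ] (∀ n → N ℕ.≤ n → seq x n ℚ.≤ seq y n ℚ.+ ε)

open _≤_ public

private
  half-pos : ∀ {ε} → 0ℚ ℚ.< ε → 0ℚ ℚ.< ½ ℚ.* ε
  half-pos {ε} 0<ε =
    ℚ.positive⁻¹ (½ ℚ.* ε) {{ℚ.pos*pos⇒pos ½ ε {{positive 0<ε}}}}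

  half+half : ∀ ε → ½ ℚ.* ε ℚ.+ ½ ℚ.* ε ≡ ε
  half+half ε = trans (sym (ℚ.*-distribʳ-+ ε ½ ½)) (ℚ.*-identityˡ ε)

const-cauchy : ∀ q → IsCauchy (λ _ → q)
const-cauchy q ε 0<ε =
  0 , λ _ _ _ _ → subst (ℚ._≤ ε) (sym (cong ℚ.∣_∣ (ℚ.+-inverseʳ q))) (ℚ.<⇒≤ 0<ε)

+-cauchy : ∀ s t → IsCauchy s → IsCauchy t → IsCauchy (λ n → s n ℚ.+ t n)
+-cauchy s t cs ct ε 0<ε with cs _ (half-pos 0<ε) | ct _ (half-pos 0<ε)
... | M , hs | N , ht = M ⊔ N , λ m n p q → begin
  ℚ.∣ (s m ℚ.+ t m) ℚ.- (s n ℚ.+ t n) ∣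
    ≡⟨ cong ℚ.∣_∣ (rearrange (s m) (t m) (s n) (t n)) ⟩
  ℚ.∣ (s m ℚ.- s n) ℚ.+ (t m ℚ.- t n) ∣
    ≤⟨ ℚ.∣p+q∣≤∣p∣+∣q∣ (s m ℚ.- s n) (t m ℚ.- t n) ⟩
  ℚ.∣ s m ℚ.- s n ∣ ℚ.+ ℚ.∣ t m ℚ.- t n ∣
    ≤⟨ ℚ.+-mono-≤ (hs m n (ℕ.m⊔n≤o⇒m≤o M N p) (ℕ.m⊔n≤o⇒m≤o M N q))
                  (ht m n (ℕ.m⊔n≤o⇒n≤o M N p) (ℕ.m⊔n≤o⇒n≤o M N q)) ⟩
  ½ ℚ.* ε ℚ.+ ½ ℚ.* ε
    ≡⟨ half+half ε ⟩
  ε ∎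
  where
  open ℚ.≤-Reasoning
  open +-*-Solver using (solve; _:+_; _:-_; _:=_)
  rearrange : ∀ a b c d → (a ℚ.+ b) ℚ.- (c ℚ.+ d) ≡ (a ℚ.- c) ℚ.+ (b ℚ.- d)
  rearrange = solve 4 (λ a b c d → (a :+ b) :- (c :+ d) := (a :- c) :+ (b :- d)) refl

neg-cauchy : ∀ s → IsCauchy s → IsCauchy (λ n → ℚ.- s n)
neg-cauchy s cs ε 0<ε with cs ε 0<ε
... | N , h = N , λ m n p q →
  subst (ℚ._≤ ε)
    (trans (sym (ℚ.∣-p∣≡∣p∣ (s m ℚ.- s n)))
           (cong ℚ.∣_∣ (ℚ.neg-distrib-+ (s m) (ℚ.- s n))))
    (h m n p q)

abs-cauchy : ∀ s → IsCauchy s → IsCauchy (λ n → ℚ.∣ s n ∣)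
abs-cauchy s cs ε 0<ε with cs ε 0<ε
... | N , h = N , λ m n p q → bound (s m) (s n) (h m n p q) (h n m q p)
  where
  open ℚ.≤-Reasoning
  open +-*-Solver using (solve; _:+_; _:-_; :-_; _:=_)
  half-bound : ∀ a b → ℚ.∣ a ℚ.- b ∣ ℚ.≤ ε → ℚ.∣ a ∣ ℚ.- ℚ.∣ b ∣ ℚ.≤ ε
  half-bound a b d = begin
    ℚ.∣ a ∣ ℚ.- ℚ.∣ b ∣
      ≡⟨ cong (λ z → ℚ.∣ z ∣ ℚ.- ℚ.∣ b ∣)
           (solve 2 (λ a b → a := (a :- b) :+ b) refl a b) ⟩
    ℚ.∣ (a ℚ.- b) ℚ.+ b ∣ ℚ.- ℚ.∣ b ∣
      ≤⟨ ℚ.+-monoˡ-≤ (ℚ.- ℚ.∣ b ∣) (ℚ.∣p+q∣≤∣p∣+∣q∣ (a ℚ.- b) b) ⟩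
    (ℚ.∣ a ℚ.- b ∣ ℚ.+ ℚ.∣ b ∣) ℚ.- ℚ.∣ b ∣
      ≡⟨ solve 2 (λ a b → (a :+ b) :- b := a) refl ℚ.∣ a ℚ.- b ∣ ℚ.∣ b ∣ ⟩
    ℚ.∣ a ℚ.- b ∣
      ≤⟨ d ⟩
    ε ∎
  bound : ∀ a b → ℚ.∣ a ℚ.- b ∣ ℚ.≤ ε → ℚ.∣ b ℚ.- a ∣ ℚ.≤ ε →
          ℚ.∣ ℚ.∣ a ∣ ℚ.- ℚ.∣ b ∣ ∣ ℚ.≤ ε
  bound a b d e with ℚ.∣p∣≡p∨∣p∣≡-p (ℚ.∣ a ∣ ℚ.- ℚ.∣ b ∣)
  ... | inj₁ eq = subst (ℚ._≤ ε) (sym eq) (half-bound a b d)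
  ... | inj₂ eq = subst (ℚ._≤ ε)
    (sym (trans eq (solve 2 (λ a b → :- (a :- b) := b :- a) refl ℚ.∣ a ∣ ℚ.∣ b ∣)))
    (half-bound b a e)

cauchy-bounded : ∀ s → IsCauchy s →
  ∃[ B ] ∃[ N ] (0ℚ ℚ.< B × (∀ n → N ℕ.≤ n → ℚ.∣ s n ∣ ℚ.≤ B))
cauchy-bounded s cs with cs 1ℚ (ℚ.positive⁻¹ 1ℚ)
... | N , h =
  1ℚ ℚ.+ ℚ.∣ s N ∣ , N ,
  ℚ.+-mono-<-≤ (ℚ.positive⁻¹ 1ℚ) (ℚ.0≤∣p∣ (s N)) ,
  λ n p → begin
    ℚ.∣ s n ∣
      ≡⟨ cong ℚ.∣_∣ (solve 2 (λ a b → a := (a :- b) :+ b) refl (s n) (s N)) ⟩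
    ℚ.∣ (s n ℚ.- s N) ℚ.+ s N ∣
      ≤⟨ ℚ.∣p+q∣≤∣p∣+∣q∣ (s n ℚ.- s N) (s N) ⟩
    ℚ.∣ s n ℚ.- s N ∣ ℚ.+ ℚ.∣ s N ∣
      ≤⟨ ℚ.+-monoˡ-≤ ℚ.∣ s N ∣ (h n N p ℕ.≤-refl) ⟩
    1ℚ ℚ.+ ℚ.∣ s N ∣ ∎
  where
  open ℚ.≤-Reasoning
  open +-*-Solver using (solve; _:+_; _:-_; _:=_)

private
  scaled-bound : ∀ B → 0ℚ ℚ.< B → ∀ ε → 0ℚ ℚ.< ε →
    ∃[ δ ] (0ℚ ℚ.< δ ×
      (∀ a d → ℚ.∣ a ∣ ℚ.≤ B → ℚ.∣ d ∣ ℚ.≤ δ → ℚ.∣ a ℚ.* d ∣ ℚ.≤ ε))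
  scaled-bound B 0<B ε 0<ε = δ , 0<δ , λ a d ha hd → begin
    ℚ.∣ a ℚ.* d ∣
      ≡⟨ ℚ.∣p*q∣≡∣p∣*∣q∣ a d ⟩
    ℚ.∣ a ∣ ℚ.* ℚ.∣ d ∣
      ≤⟨ ℚ.*-monoʳ-≤-nonNeg ℚ.∣ d ∣ {{ℚ.∣-∣-nonNeg d}} ha ⟩
    B ℚ.* ℚ.∣ d ∣
      ≤⟨ ℚ.*-monoˡ-≤-nonNeg B {{nonNegative (ℚ.<⇒≤ 0<B)}} hd ⟩
    B ℚ.* (ℚ.1/ B ℚ.* ε)
      ≡⟨ sym (ℚ.*-assoc B (ℚ.1/ B) ε) ⟩
    (B ℚ.* ℚ.1/ B) ℚ.* ε
      ≡⟨ cong (ℚ._* ε) (ℚ.*-inverseʳ B) ⟩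
    1ℚ ℚ.* ε
      ≡⟨ ℚ.*-identityˡ ε ⟩
    ε ∎
    where
    open ℚ.≤-Reasoning
    instance
      B-pos : Positive B
      B-pos = positive 0<B
      B-nonZero : ℚ.NonZero B
      B-nonZero = ℚ.pos⇒nonZero B
    δ : ℚ
    δ = ℚ.1/ B ℚ.* ε
    0<δ : 0ℚ ℚ.< δ
    0<δ = ℚ.positive⁻¹ δ
      {{ℚ.pos*pos⇒pos (ℚ.1/ B) {{ℚ.1/pos⇒pos B}} ε {{positive 0<ε}}}}

private
  *-close : ∀ ε a b c d →
    ℚ.∣ a ℚ.* (b ℚ.- d) ∣ ℚ.≤ ½ ℚ.* ε → ℚ.∣ d ℚ.* (a ℚ.- c) ∣ ℚ.≤ ½ ℚ.* ε →
    ℚ.∣ a ℚ.* b ℚ.- c ℚ.* d ∣ ℚ.≤ ε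
  *-close ε a b c d h₁ h₂ = begin
    ℚ.∣ a ℚ.* b ℚ.- c ℚ.* d ∣
      ≡⟨ cong ℚ.∣_∣ (rearrange a b c d) ⟩
    ℚ.∣ a ℚ.* (b ℚ.- d) ℚ.+ d ℚ.* (a ℚ.- c) ∣
      ≤⟨ ℚ.∣p+q∣≤∣p∣+∣q∣ (a ℚ.* (b ℚ.- d)) (d ℚ.* (a ℚ.- c)) ⟩
    ℚ.∣ a ℚ.* (b ℚ.- d) ∣ ℚ.+ ℚ.∣ d ℚ.* (a ℚ.- c) ∣
      ≤⟨ ℚ.+-mono-≤ h₁ h₂ ⟩
    ½ ℚ.* ε ℚ.+ ½ ℚ.* ε
      ≡⟨ half+half ε ⟩
    ε ∎
    where
    open ℚ.≤-Reasoning
    open +-*-Solver using (solve; _:+_; _:*_; _:-_; _:=_)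
    rearrange : ∀ a b c d →
      a ℚ.* b ℚ.- c ℚ.* d ≡ a ℚ.* (b ℚ.- d) ℚ.+ d ℚ.* (a ℚ.- c)
    rearrange = solve 4
      (λ a b c d → a :* b :- c :* d := a :* (b :- d) :+ d :* (a :- c)) refl

*-cauchy : ∀ s t → IsCauchy s → IsCauchy t → IsCauchy (λ n → s n ℚ.* t n)
*-cauchy s t cs ct ε 0<ε =
  let A , K , 0<A , hA = cauchy-bounded s cs
      B , L , 0<B , hB = cauchy-bounded t ct
      α , 0<α , smallA = scaled-bound A 0<A (½ ℚ.* ε) (half-pos 0<ε)
      β , 0<β , smallB = scaled-bound B 0<B (½ ℚ.* ε) (half-pos 0<ε)
      M , ht = ct α 0<α
      N , hs = cs β 0<β
  in (K ⊔ L) ⊔ (M ⊔ N) , λ m n p q →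
  let p₁ = ℕ.m⊔n≤o⇒m≤o (K ⊔ L) (M ⊔ N) p
      p₂ = ℕ.m⊔n≤o⇒n≤o (K ⊔ L) (M ⊔ N) p
      q₁ = ℕ.m⊔n≤o⇒m≤o (K ⊔ L) (M ⊔ N) q
      q₂ = ℕ.m⊔n≤o⇒n≤o (K ⊔ L) (M ⊔ N) q
  in *-close ε (s m) (t m) (s n) (t n)
       (smallA (s m) (t m ℚ.- t n) (hA m (ℕ.m⊔n≤o⇒m≤o K L p₁))
         (ht m n (ℕ.m⊔n≤o⇒m≤o M N p₂) (ℕ.m⊔n≤o⇒m≤o M N q₂)))
       (smallB (t n) (s m ℚ.- s n) (hB n (ℕ.m⊔n≤o⇒n≤o K L q₁))
         (hs m n (ℕ.m⊔n≤o⇒n≤o M N p₂) (ℕ.m⊔n≤o⇒n≤o M N q₂)))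

fromℚ : ℚ → ℝ
fromℚ q = mkℝ (λ _ → q) (const-cauchy q)

fromℕ : ℕ → ℝ
fromℕ k = fromℚ (+ k ℚ./ 1)

0ℝ 1ℝ : ℝ
0ℝ = fromℚ 0ℚ
1ℝ = fromℚ 1ℚ

infixl 6 _+_ _-_
infixl 7 _*_
infix  8 -_

_+_ : ℝ → ℝ → ℝ
x + y = mkℝ (λ n → seq x n ℚ.+ seq y n) (+-cauchy (seq x) (seq y) (cauchy x) (cauchy y))

_*_ : ℝ → ℝ → ℝ
x * y = mkℝ (λ n → seq x n ℚ.* seq y n) (*-cauchy (seq x) (seq y) (cauchy x) (cauchy y))

-_ : ℝ → ℝ
-_ x = mkℝ (λ n → ℚ.- seq x n) (neg-cauchy (seq x) (cauchy x))

_-_ : ℝ → ℝ → ℝ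
x - y = x + (- y)

abs : ℝ → ℝ
abs x = mkℝ (λ n → ℚ.∣ seq x n ∣) (abs-cauchy (seq x) (cauchy x))

ℝ-rawRing : RawRing 0ℓ 0ℓ
ℝ-rawRing = record
  { Carrier = ℝ ; _≈_ = _≈_ ; _+_ = _+_ ; _*_ = _*_ ; -_ = -_ ; 0# = 0ℝ ; 1# = 1ℝ }

------------------------------------------------------------------------
-- Matrices and determinants

module _ {c ℓ} (R : RawRing c ℓ) where
  private module R = RawRing R

  Matrix : ℕ → Set c
  Matrix n = Fin n → Fin n → R.Carrier

  ∑ ∏ : ∀ {n} → Vector R.Carrier n → R.Carrier
  ∑ = RawMonoidDefs.sum R.+-rawMonoid
  ∏ = RawMonoidDefs.sum R.*-rawMonoid

  sign : ℕ → R.Carrier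
  sign zero    = R.1#
  sign (suc k) = R.- sign k

  -- Laplace expansion along the first row.
  det : ∀ {n} → Matrix n → R.Carrier
  det {zero}  M = R.1#
  det {suc n} M = ∑ λ j →
    sign (toℕ j) R.* (M zero j R.* det (λ i k → M (suc i) (punchIn j k)))

identity : ∀ {n} → Matrix ℝ-rawRing n
identity i j = if does (i Fin.≟ j) then 1ℝ else 0ℝ

-- The value at x of the characteristic polynomial det (x I − A).
charPoly : ∀ {n} → Matrix ℝ-rawRing n → ℝ → ℝ
charPoly A x = det ℝ-rawRing λ i j → x * identity i j - A i j

-- μ lists the eigenvalues of A with (algebraic) multiplicity, i.e. the
-- characteristic polynomial equals ∏ᵢ (x − μᵢ).  As ℝ is infinite, equality
-- of polynomials is equality of their values at every real x.
IsSpectrum : ∀ {n} → Matrix ℝ-rawRing n → Vector ℝ n → Set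
IsSpectrum A μ = ∀ x → charPoly A x ≈ ∏ ℝ-rawRing (λ i → x - μ i)

------------------------------------------------------------------------
-- Graphs

-- A finite simple undirected graph with vertex set Fin n.
record Graph (n : ℕ) : Set₁ where
  field
    Adj        : Rel (Fin n) 0ℓ
    adj?       : Decidable Adj
    adj-sym    : Symmetric Adj
    adj-irrefl : Irreflexive _≡_ Adj

adjacencyMatrix : ∀ {n} → Graph n → Matrix ℝ-rawRing n
adjacencyMatrix G i j = if does (Graph.adj? G i j) then 1ℝ else 0ℝ

-- E is the energy of G.  Stated as a relation, since the eigenvalues are
-- specified (uniquely up to order) rather than computed.
IsEnergy : ∀ {n} → Graph n → ℝ → Set
IsEnergy G E = ∃[ μ ]
  (IsSpectrum (adjacencyMatrix G) μ × E ≈ ∑ ℝ-rawRing (λ i → abs (μ i)))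

-- The closed walk x, y₁, …, yₖ, x with k ≥ 2 and x, y₁, …, yₖ distinct.
record Cycle {n} (G : Graph n) : Set where
  field
    start    : Fin n
    rest     : List (Fin n)
    long     : 2 ℕ.≤ length rest
    distinct : Unique (start ∷ rest)
    walk     : Linked (Graph.Adj G) (start ∷ (rest ∷ʳ start))

record IsTree {n} (G : Graph n) : Set where
  field
    nonempty  : 1 ℕ.≤ n
    connected : ∀ i j → Star (Graph.Adj G) i j
    acyclic   : ¬ Cycle G

IsVertexCover : ∀ {n} → Graph n → Subset n → Set
IsVertexCover G X = ∀ i j → Graph.Adj G i j → i ∈ X ⊎ j ∈ X

record IsVertexCoverNumber {n} (G : Graph n) (τ : ℕ) : Set where
  field
    attained : ∃[ X ] (IsVertexCover G X × ∣ X ∣ ≡ τ)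
    minimal  : ∀ X → IsVertexCover G X → τ ℕ.≤ ∣ X ∣

complete : ∀ n → Graph n
complete n = record
  { Adj        = _≢_
  ; adj?       = λ i j → Dec.¬? (i Fin.≟ j)
  ; adj-sym    = ≢-sym
  ; adj-irrefl = λ i≡j i≢j → i≢j i≡j
  }

infix 4 _≅_

_≅_ : ∀ {m n} → Graph m → Graph n → Set
_≅_ {m} {n} G H = ∃ λ (f : Fin m ↔ Fin n) →
  ∀ i j → Graph.Adj G i j ⇔ Graph.Adj H (Inverse.to f i) (Inverse.to f j)

{-# OPTIONS --safe #-}
module Submission where

-- Removing a leaf v with neighbour w from a forest G gives φ(G) = x φ(G - v) - φ(G - v - w) for the characteristic
-- polynomials, so that φ(G) = ∑ₖ (-1)ᵏ mₖ xⁿ⁻²ᵏ where mₖ counts the matchings with k edges.  The same induction shows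
-- that the last non-zero mₖ has k = τ.  Hence exactly 2τ eigenvalues are non-zero and the absolute value of their
-- product is the positive integer m_τ, and the inequality of arithmetic and geometric means yields E ≥ 2τ.  Applied
-- to the products of pairs of eigenvalues, it bounds the mixed terms of E² from below; together with
-- ∑ μ² = 2 m₁ = 2 (n - 1), equality E = 2τ forces 2 (n - 1) ≤ 2τ ≤ n, that is n ≤ 2.
-- Eigenvalues are compared with 0 and 1 under double negations, which is harmless because ≤ on ℝ is ¬¬-stable.

-- The characteristic polynomial is given only by its values, so comparing it with the matching
-- polynomial requires that values determine coefficients (`ev-injective`). Coefficients are counted
-- from the leading one: eigenvalues equal to zero then leave every coefficient in its place, and
-- the number of non-zero eigenvalues is the index of the last coefficient that does not vanish.
-- Integrality carries the bound: that coefficient has absolute value m_τ, a positive integer, hence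
-- at least 1. The inequality of means is therefore needed only for a product that is at least 1,
-- and no roots are extracted. Matchings themselves are never formed. The recursion defines numbers
-- m_k, and the induction carries along what a count of matchings satisfies: m_k = 0 if 2k exceeds
-- the number of vertices or k exceeds the size of some vertex cover, and some cover X has m_k > 0
-- for k = |X|. The last two facts together are König's theorem for forests. The bounds on m_1, the
-- number of edges, are carried along for the equality case.

open import Defs using (Matrix; det; sign; ∑; ∏; Graph; Cycle; IsVertexCover; IsTree; IsVertexCoverNumber; complete; _≅_)
open import Algebra.Bundles using (CommutativeRing)
open import Algebra.Solver.Ring.AlmostCommutativeRing using (AlmostCommutativeRing; fromCommutativeRing; _-Raw-AlmostCommutative⟶_)
open import Algebra.Structures using (IsCommutativeRing)
open import Data.Bool.Base using (true; false; if_then_else_)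
open import Data.Fin.Base using (Fin; zero; suc; punchIn; punchOut; toℕ)
open import Data.Fin.Permutation using (↔⇒≡)
import Data.Fin.Properties as Fin
open import Data.Fin.Subset using (Subset; _∈_; ∣_∣; inside; outside)
open import Data.Integer.Base as ℤ using (ℤ; +_; -[1+_]; _⊖_)
import Data.Integer.Properties as ℤ
open import Data.Integer.Solver using () renaming (module +-*-Solver to ℤ-Solver)
open import Data.List.Base using (List; []; _∷_; foldr; map; length; _++_; _∷ʳ_; lookup; tabulate)
import Data.List.Membership.DecPropositional as Membership
open import Data.List.Membership.Propositional.Properties using (∈-∃++; ∈-lookup)
open import Data.List.Properties using (length-++; length-map; map-++; length-tabulate)
open import Data.List.Relation.Unary.All as All using (All; []; _∷_)
import Data.List.Relation.Unary.All.Properties as All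
open import Data.List.Relation.Unary.AllPairs using (AllPairs; []; _∷_)
open import Data.List.Relation.Unary.Linked using (Linked; []; [-]; _∷_)
import Data.List.Relation.Unary.Linked.Properties as Linked
open import Data.List.Relation.Unary.Unique.Propositional using (Unique)
import Data.List.Relation.Unary.Unique.Propositional.Properties as Unique
open import Data.Maybe.Base using (Maybe; just; nothing)
open import Data.Nat.Base as ℕ using (ℕ; zero; suc; _⊔_; s≤s; z≤n)
import Data.Nat.Properties as ℕ
open import Data.Nat.Solver using () renaming (module +-*-Solver to ℕ-Solver)
open import Data.Product.Base using (∃; _×_; _,_; ∃-syntax)
open import Data.Rational.Base as ℚ using (ℚ; 0ℚ; 1ℚ; ½; Positive; positive; nonNegative)
import Data.Rational.Properties as ℚ
open import Data.Rational.Solver using (module +-*-Solver)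
open import Data.Rational.Unnormalised.Base as ℚᵘ using (mkℚᵘ; *≡*)
import Data.Rational.Unnormalised.Properties as ℚᵘ
import Data.Sign.Base as Sign
open import Data.Sum.Base as Sum using (_⊎_; inj₁; inj₂)
import Data.Vec.Base as Vec
open import Data.Vec.Functional using (Vector; updateAt)
open import Data.Vec.Functional.Properties using (updateAt-updates; updateAt-minimal)
import Data.Vec.Properties as Vec
open import Function.Base using (_∘_)
open import Function.Bundles using (_⇔_; mk⇔; Equivalence)
open import Function.Construct.Identity using (↔-id)
open import Level using (0ℓ)
open import Relation.Binary.Bundles using (Preorder)
open import Relation.Binary.Construct.Closure.ReflexiveTransitive as Star using (Star; _◅_)
open import Relation.Binary.Definitions using (tri<; tri≈; tri>)
open import Relation.Binary.PropositionalEquality.Core as ≡ using (_≡_; _≢_)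
open import Relation.Nullary.Decidable using (yes; no; does; dec-true; dec-false; _×-dec_; ¬?; decidable-stable)
open import Relation.Nullary.Negation.Core using (contradiction; ¬_)

-- The ring solver cancels terms only if equality of coefficients is decidable; integer coefficients serve for
-- every commutative ring.
module IntegerCoefficients (R : CommutativeRing 0ℓ 0ℓ) where

  open CommutativeRing R hiding (zero)
  open import Algebra.Properties.Ring ring using (-‿distribˡ-*; -‿distribʳ-*; -0#≈0#; -‿+-comm; -‿involutive)
  open import Algebra.Properties.Semiring.Mult.TCOptimised semiring using (×-homo-+; ×1-homo-*; 1+×) renaming (_×_ to _·_)
  open import Relation.Binary.Reasoning.Setoid setoid

  -- With the optimised multiples `ι 1` reduces to `1#`, so that the constant `con (+ 1)` of the
  -- solver denotes `1#` itself.
  ι : ℕ → Carrier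
  ι n = n · 1#

  ι-suc : ∀ n → ι (suc n) ≈ 1# + ι n
  ι-suc n = 1+× n 1#

  -- Identifies `fromℕ`, which is built from fractions, with `ι` through its recursion alone.
  ι-unique : ∀ (f : ℕ → Carrier) → f 0 ≈ 0# → (∀ n → f (suc n) ≈ 1# + f n) → ∀ n → f n ≈ ι n
  ι-unique f f-0 f-suc zero    = f-0
  ι-unique f f-0 f-suc (suc n) =
    trans (f-suc n) (trans (+-congˡ (ι-unique f f-0 f-suc n)) (sym (ι-suc n)))

  ⟦_⟧ : ℤ → Carrier
  ⟦ + n ⟧      = ι n
  ⟦ -[1+ n ] ⟧ = - ι (suc n)

  ⟦⟧-⊖ : ∀ m n → ⟦ m ⊖ n ⟧ ≈ ι m - ι n
  ⟦⟧-⊖ zero    zero    = sym (trans (+-congˡ -0#≈0#) (+-identityʳ 0#))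
  ⟦⟧-⊖ zero    (suc n) = sym (+-identityˡ _)
  ⟦⟧-⊖ (suc m) zero    = sym (trans (+-congˡ -0#≈0#) (+-identityʳ _))
  ⟦⟧-⊖ (suc m) (suc n) = begin
    ⟦ suc m ⊖ suc n ⟧             ≡⟨ ≡.cong ⟦_⟧ (ℤ.[1+m]⊖[1+n]≡m⊖n m n) ⟩
    ⟦ m ⊖ n ⟧                     ≈⟨ ⟦⟧-⊖ m n ⟩
    ι m - ι n                     ≈⟨ +-congʳ (+-identityʳ _) ⟨
    (ι m + 0#) - ι n              ≈⟨ +-congʳ (+-congˡ (-‿inverseʳ 1#)) ⟨
    (ι m + (1# - 1#)) - ι n       ≈⟨ +-congʳ (trans (sym (+-assoc _ _ _)) (+-congʳ (+-comm _ _))) ⟩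
    ((1# + ι m) - 1#) - ι n       ≈⟨ +-assoc _ _ _ ⟩
    (1# + ι m) + (- 1# - ι n)     ≈⟨ +-cong (sym (ι-suc m)) (trans (-‿+-comm _ _) (-‿cong (sym (ι-suc n)))) ⟩
    ι (suc m) - ι (suc n)         ∎

  ⟦⟧-+ : ∀ i j → ⟦ i ℤ.+ j ⟧ ≈ ⟦ i ⟧ + ⟦ j ⟧
  ⟦⟧-+ (+ m)      (+ n)      = ×-homo-+ 1# m n
  ⟦⟧-+ (+ m)      -[1+ n ]   = ⟦⟧-⊖ m (suc n)
  ⟦⟧-+ -[1+ m ]   (+ n)      = trans (⟦⟧-⊖ n (suc m)) (+-comm _ _)
  ⟦⟧-+ -[1+ m ]   -[1+ n ]   = begin
    - ι (suc (suc (m ℕ.+ n)))      ≡⟨ ≡.cong (λ k → - ι (suc k)) (ℕ.+-suc m n) ⟨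
    - ι (suc m ℕ.+ suc n)          ≈⟨ -‿cong (×-homo-+ 1# (suc m) (suc n)) ⟩
    - (ι (suc m) + ι (suc n))      ≈⟨ -‿+-comm _ _ ⟨
    - ι (suc m) - ι (suc n)        ∎

  ⟦⟧-neg : ∀ i → ⟦ ℤ.- i ⟧ ≈ - ⟦ i ⟧
  ⟦⟧-neg (+ zero)   = sym -0#≈0#
  ⟦⟧-neg (+ suc n)  = refl
  ⟦⟧-neg -[1+ n ]   = sym (-‿involutive _)

  ⟦-⟧ : ∀ n → ⟦ Sign.- ℤ.◃ n ⟧ ≈ - ι n
  ⟦-⟧ zero    = sym -0#≈0#
  ⟦-⟧ (suc n) = refl

  ⟦+⟧ : ∀ n → ⟦ Sign.+ ℤ.◃ n ⟧ ≈ ι n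
  ⟦+⟧ zero    = refl
  ⟦+⟧ (suc n) = refl

  ⟦⟧-* : ∀ i j → ⟦ i ℤ.* j ⟧ ≈ ⟦ i ⟧ * ⟦ j ⟧
  ⟦⟧-* (+ m)    (+ n)    = trans (⟦+⟧ (m ℕ.* n)) (×1-homo-* m n)
  ⟦⟧-* (+ m)    -[1+ n ] = trans (⟦-⟧ (m ℕ.* suc n)) (trans (-‿cong (×1-homo-* m (suc n))) (-‿distribʳ-* _ _))
  ⟦⟧-* -[1+ m ] (+ n)    = trans (⟦-⟧ (suc m ℕ.* n)) (trans (-‿cong (×1-homo-* (suc m) n)) (-‿distribˡ-* _ _))
  ⟦⟧-* -[1+ m ] -[1+ n ] = begin
    ι (suc m ℕ.* suc n)          ≈⟨ ×1-homo-* (suc m) (suc n) ⟩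
    ι (suc m) * ι (suc n)        ≈⟨ -‿involutive _ ⟨
    - - (ι (suc m) * ι (suc n))  ≈⟨ -‿cong (-‿distribʳ-* _ _) ⟩
    - (ι (suc m) * - ι (suc n))  ≈⟨ -‿distribˡ-* _ _ ⟩
    - ι (suc m) * - ι (suc n)    ∎

  almostCommutativeRing : AlmostCommutativeRing 0ℓ 0ℓ
  almostCommutativeRing = fromCommutativeRing R

  morphism : ℤ.+-*-rawRing -Raw-AlmostCommutative⟶ almostCommutativeRing
  morphism = record
    { ⟦_⟧ = ⟦_⟧ ; +-homo = ⟦⟧-+ ; *-homo = ⟦⟧-* ; -‿homo = ⟦⟧-neg ; 0-homo = refl ; 1-homo = refl }

  coeff≟ : ∀ i j → Maybe (⟦ i ⟧ ≈ ⟦ j ⟧)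
  coeff≟ i j with i ℤ.≟ j
  ... | yes ≡.refl = just refl
  ... | no _       = nothing

  open import Algebra.Solver.Ring ℤ.+-*-rawRing almostCommutativeRing morphism coeff≟ public
    using (solve; _:=_; _:+_; _:*_; _:-_; :-_; con)

-- Deleting two indices in either order

-- The place that `i` takes once `punchIn i j` has been deleted. Deleting `i` and then `j` leaves
-- the same indices as deleting `punchIn i j` and then `swap i j`.
swap : ∀ {n} → Fin (suc n) → Fin n → Fin n
swap {suc n} zero    j       = zero
swap {suc n} (suc i) zero    = i
swap {suc n} (suc i) (suc j) = suc (swap i j)

punchIn-swap : ∀ {n} (i : Fin (suc n)) j → punchIn (punchIn i j) (swap i j) ≡ i
punchIn-swap {suc n} zero    j       = ≡.refl
punchIn-swap {suc n} (suc i) zero    = ≡.refl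
punchIn-swap {suc n} (suc i) (suc j) = ≡.cong suc (punchIn-swap i j)

punchIn-punchIn : ∀ {n} (i : Fin (suc (suc n))) j k →
  punchIn (punchIn i j) (punchIn (swap i j) k) ≡ punchIn i (punchIn j k)
punchIn-punchIn zero    j       k       = ≡.refl
punchIn-punchIn (suc i) zero    k       = ≡.refl
punchIn-punchIn (suc i) (suc j) zero    = ≡.refl
punchIn-punchIn {suc n} (suc i) (suc j) (suc k) = ≡.cong suc (punchIn-punchIn i j k)

punchIn-split : ∀ {n} (i j : Fin (suc n)) → j ≡ i ⊎ ∃ λ k → j ≡ punchIn i k
punchIn-split i j with i Fin.≟ j
... | yes i≡j = inj₁ (≡.sym i≡j)
... | no  i≢j = inj₂ (punchOut i≢j , ≡.sym (Fin.punchIn-punchOut i≢j))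

-- Determinants: rows and columns with few non-zero entries

module Determinants (R : CommutativeRing 0ℓ 0ℓ) where

  open CommutativeRing R hiding (zero)
  open IntegerCoefficients R using (solve; _:=_; _:*_; :-_; con)
  open import Algebra.Properties.CommutativeMonoid.Sum +-commutativeMonoid
    using (sum; sum-cong-≋; sum-replicate-zero; sum-remove; ∑-distrib-+)
  open import Algebra.Properties.Semiring.Sum semiring using (*-distribˡ-sum)
  open import Relation.Binary.Reasoning.Setoid setoid

  Mat : ℕ → Set
  Mat = Matrix rawRing

  Det : ∀ {n} → Mat n → Carrier
  Det = det rawRing

  sgn : ∀ {n} → Fin n → Carrier
  sgn i = sign rawRing (toℕ i)

  minor : ∀ {n} → Fin (suc n) → Fin (suc n) → Mat (suc n) → Mat n
  minor r c M i j = M (punchIn r i) (punchIn c j)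

  sgn-sgn : ∀ {n} (i : Fin n) → sgn i * sgn i ≈ 1#
  sgn-sgn zero    = *-identityˡ 1#
  sgn-sgn (suc i) = trans (solve 1 (λ a → :- a :* :- a := a :* a) refl (sgn i)) (sgn-sgn i)

  -- Either `punchIn i j` exceeds `j` by one or `swap i j` falls short of `i` by one, and never
  -- both; the sum of the two indices thus changes parity.
  sgn-swap : ∀ {n} (i : Fin (suc n)) j → sgn (punchIn i j) * sgn (swap i j) ≈ - (sgn i * sgn j)
  sgn-swap {suc n} zero    j       = solve 1 (λ a → :- a :* con (+ 1) := :- (con (+ 1) :* a)) refl (sgn j)
  sgn-swap {suc n} (suc i) zero    = solve 1 (λ a → con (+ 1) :* a := :- (:- a :* con (+ 1))) refl (sgn i)
  sgn-swap {suc n} (suc i) (suc j) = begin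
    - sgn (punchIn i j) * - sgn (swap i j)
      ≈⟨ solve 2 (λ a b → :- a :* :- b := a :* b) refl (sgn (punchIn i j)) (sgn (swap i j)) ⟩
    sgn (punchIn i j) * sgn (swap i j)
      ≈⟨ sgn-swap i j ⟩
    - (sgn i * sgn j)
      ≈⟨ solve 2 (λ a b → :- (a :* b) := :- (:- a :* :- b)) refl (sgn i) (sgn j) ⟩
    - (- sgn i * - sgn j) ∎

  det-cong : ∀ {n} {M N : Mat n} → (∀ i j → M i j ≈ N i j) → Det M ≈ Det N
  det-cong {zero}  M≈N = refl
  det-cong {suc n} M≈N = sum-cong-≋ λ j →
    *-congˡ {sgn j} (*-cong (M≈N zero j) (det-cong λ i k → M≈N (suc i) (punchIn j k)))

  det-row-+ : ∀ {n} (r : Fin n) {M N P : Mat n} →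
    (∀ j → M r j ≈ N r j + P r j) →
    (∀ i → i ≢ r → ∀ j → M i j ≈ N i j) → (∀ i → i ≢ r → ∀ j → M i j ≈ P i j) →
    Det M ≈ Det N + Det P
  det-row-+ {suc n} zero {M} {N} {P} Mr MN MP = begin
    sum (λ j → sgn j * (M zero j * Det (minor zero j M)))
      ≈⟨ sum-cong-≋ (λ j → trans
           (*-congˡ {sgn j} (trans (*-congʳ (Mr j)) (trans (distribʳ _ _ _)
             (+-cong (*-congˡ {N zero j} (det-cong λ i k → MN (suc i) (λ ()) (punchIn j k)))
                     (*-congˡ {P zero j} (det-cong λ i k → MP (suc i) (λ ()) (punchIn j k)))))))
           (distribˡ (sgn j) _ _)) ⟩
    sum (λ j → sgn j * (N zero j * Det (minor zero j N)) + sgn j * (P zero j * Det (minor zero j P)))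
      ≈⟨ ∑-distrib-+ (λ j → sgn j * (N zero j * Det (minor zero j N)))
                     (λ j → sgn j * (P zero j * Det (minor zero j P))) ⟩
    Det N + Det P ∎
  det-row-+ {suc n} (suc r) {M} {N} {P} Mr MN MP = begin
    sum (λ j → sgn j * (M zero j * Det (minor zero j M)))
      ≈⟨ sum-cong-≋ (λ j → trans (*-congˡ {sgn j} (trans
             (*-congˡ {M zero j} (det-row-+ r (λ k → Mr (punchIn j k))
               (λ i i≢r k → MN (suc i) (i≢r ∘ Fin.suc-injective) (punchIn j k))
               (λ i i≢r k → MP (suc i) (i≢r ∘ Fin.suc-injective) (punchIn j k))))
             (trans (distribˡ _ _ _) (+-cong (*-congʳ (MN zero (λ ()) j)) (*-congʳ (MP zero (λ ()) j))))))
           (distribˡ (sgn j) _ _)) ⟩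
    sum (λ j → sgn j * (N zero j * Det (minor zero j N)) + sgn j * (P zero j * Det (minor zero j P)))
      ≈⟨ ∑-distrib-+ (λ j → sgn j * (N zero j * Det (minor zero j N)))
                     (λ j → sgn j * (P zero j * Det (minor zero j P))) ⟩
    Det N + Det P ∎

  sum-zero : ∀ {n} (t : Vector Carrier n) → (∀ i → t i ≈ 0#) → sum t ≈ 0#
  sum-zero {n} t t≈0 = trans (sum-cong-≋ t≈0) (sum-replicate-zero n)

  x*0*y≈0 : ∀ x y {z} → z ≈ 0# → x * (z * y) ≈ 0#
  x*0*y≈0 x y z≈0 = trans (*-congˡ (trans (*-congʳ z≈0) (zeroˡ y))) (zeroʳ x)

  x*y*0≈0 : ∀ x y {z} → z ≈ 0# → x * (y * z) ≈ 0#
  x*y*0≈0 x y z≈0 = trans (*-congˡ (trans (*-congˡ z≈0) (zeroʳ y))) (zeroʳ x)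

  -- The one form of Laplace's rule beyond the first row that the leaf recursion uses. Induction on
  -- `r`: after expanding along row 0, the minors have the same property one row higher, and
  -- deleting row 0 and row `r` in either order leaves the same matrix. Rows and columns are treated
  -- together because the leaf recursion uses both and the determinant is defined by rows only.
  det-single : ∀ {n} (r c : Fin (suc n)) (M : Mat (suc n)) →
    (∀ j → M r (punchIn c j) ≈ 0#) ⊎ (∀ i → M (punchIn r i) c ≈ 0#) →
    Det M ≈ (sgn r * sgn c) * (M r c * Det (minor r c M))
  det-single {n} zero c M M≈0 = begin
    sum t                               ≈⟨ sum-remove {i = c} t ⟩
    t c + sum (t ∘ punchIn c)           ≈⟨ +-congˡ (sum-zero (t ∘ punchIn c) (rest M≈0)) ⟩
    t c + 0#                            ≈⟨ +-identityʳ _ ⟩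
    t c                                 ≈⟨ *-congʳ (*-identityˡ (sgn c)) ⟨
    (1# * sgn c) * (M zero c * Det (minor zero c M)) ∎
    where
    t : Vector Carrier (suc n)
    t j = sgn j * (M zero j * Det (minor zero j M))
    -- A zero column is the case in which the single entry vanishes too; `swap c j` is the place of
    -- column `c` in the minor.
    zeroColumn : ∀ {n} (c : Fin (suc n)) (j : Fin n) (M : Mat (suc n)) →
      (∀ i → M (suc i) c ≈ 0#) → Det (minor zero (punchIn c j) M) ≈ 0#
    zeroColumn {suc n} c j M M≈0 = trans
      (det-single zero (swap c j) (minor zero (punchIn c j) M)
        (inj₂ λ i → trans (reflexive (≡.cong (M _) (punchIn-swap c j))) (M≈0 (suc i))))
      (x*0*y≈0 _ _ (trans (reflexive (≡.cong (M _) (punchIn-swap c j))) (M≈0 zero)))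
    rest : (∀ j → M zero (punchIn c j) ≈ 0#) ⊎ (∀ i → M (suc i) c ≈ 0#) → ∀ j → t (punchIn c j) ≈ 0#
    rest (inj₁ h) j = x*0*y≈0 _ _ (h j)
    rest (inj₂ h) j = x*y*0≈0 _ _ (zeroColumn c j M h)
  det-single {suc n} (suc r) c M M≈0 = begin
    sum t                               ≈⟨ sum-remove {i = c} t ⟩
    t c + sum (t ∘ punchIn c)           ≈⟨ +-congʳ (t-c M≈0) ⟩
    0# + sum (t ∘ punchIn c)            ≈⟨ +-identityˡ _ ⟩
    sum (t ∘ punchIn c)                 ≈⟨ sum-cong-≋ step ⟩
    sum (λ k → (sgn (suc r) * sgn c * M (suc r) c) * s k)
      ≈⟨ *-distribˡ-sum (sgn (suc r) * sgn c * M (suc r) c) s ⟨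
    (sgn (suc r) * sgn c * M (suc r) c) * sum s
      ≈⟨ *-assoc _ _ _ ⟩
    (sgn (suc r) * sgn c) * (M (suc r) c * Det (minor (suc r) c M)) ∎
    where
    t : Vector Carrier (suc (suc n))
    t j = sgn j * (M zero j * Det (minor zero j M))
    s : Vector Carrier (suc n)
    s k = sgn k * (M zero (punchIn c k) * Det (minor zero k (minor (suc r) c M)))
    t-c : (∀ j → M (suc r) (punchIn c j) ≈ 0#) ⊎ (∀ i → M (punchIn (suc r) i) c ≈ 0#) → t c ≈ 0#
    t-c (inj₂ h) = x*0*y≈0 _ _ (h zero)
    -- Without column `c` the whole row is zero, so any column, here the first, can be singled out.
    t-c (inj₁ h) = x*y*0≈0 _ _ (trans
      (det-single r zero (minor zero c M) (inj₁ λ j → h (suc j))) (x*0*y≈0 _ _ (h zero)))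
    zeros : ∀ k → (∀ j → M (suc r) (punchIn c j) ≈ 0#) ⊎ (∀ i → M (punchIn (suc r) i) c ≈ 0#) →
      (∀ j → M (suc r) (punchIn (punchIn c k) (punchIn (swap c k) j)) ≈ 0#) ⊎
      (∀ i → M (suc (punchIn r i)) (punchIn (punchIn c k) (swap c k)) ≈ 0#)
    zeros k (inj₁ h) = inj₁ λ j → trans (reflexive (≡.cong (M _) (punchIn-punchIn c k j))) (h (punchIn k j))
    zeros k (inj₂ h) = inj₂ λ i → trans (reflexive (≡.cong (M _) (punchIn-swap c k))) (h (suc i))
    step : ∀ k → t (punchIn c k) ≈ (sgn (suc r) * sgn c * M (suc r) c) * s k
    step k = begin
      sj * (a * Det (minor zero j M))
        ≈⟨ *-congˡ (*-congˡ (det-single r (swap c k) (minor zero j M) (zeros k M≈0))) ⟩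
      sj * (a * ((sgn r * sc′) * (M (suc r) (punchIn j (swap c k)) * Det (minor r (swap c k) (minor zero j M)))))
        ≈⟨ *-congˡ (*-congˡ (*-congˡ (*-cong (reflexive (≡.cong (M (suc r)) (punchIn-swap c k)))
             (det-cong λ i l → reflexive (≡.cong (M (suc (punchIn r i))) (punchIn-punchIn c k l)))))) ⟩
      sj * (a * ((sgn r * sc′) * (b * D)))
        ≈⟨ solve 6 (λ sj a sr sc′ b D → sj :* (a :* ((sr :* sc′) :* (b :* D))) := (sj :* sc′) :* (sr :* b :* (a :* D)))
             refl sj a (sgn r) sc′ b D ⟩
      (sj * sc′) * (sgn r * b * (a * D))
        ≈⟨ *-congʳ (sgn-swap c k) ⟩
      - (sgn c * sgn k) * (sgn r * b * (a * D))
        ≈⟨ solve 6 (λ sc sk sr b a D → :- (sc :* sk) :* (sr :* b :* (a :* D)) := (:- sr :* sc :* b) :* (sk :* (a :* D)))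
             refl (sgn c) (sgn k) (sgn r) b a D ⟩
      (- sgn r * sgn c * b) * s k ∎
      where
      j   = punchIn c k
      sj  = sgn j
      sc′ = sgn (swap c k)
      a   = M zero j
      b   = M (suc r) c
      D   = Det (minor zero k (minor (suc r) c M))

  det-isolated : ∀ {n} (v : Fin (suc n)) (M : Mat (suc n)) → (∀ j → M v (punchIn v j) ≈ 0#) →
    Det M ≈ M v v * Det (minor v v M)
  det-isolated v M M≈0 = trans (det-single v v M (inj₁ M≈0)) (trans (*-congʳ (sgn-sgn v)) (*-identityˡ _))

  -- Row `v` has at most two non-zero entries. Writing it as the sum of its diagonal part `N₁` and
  -- the rest `N₂` gives two determinants with a single-entry row. In the second, once row `v` and
  -- the column of the neighbour are deleted, column `v` retains only its entry in the row of the
  -- neighbour, so `det-single` applies again, now to a column.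
  det-leaf : ∀ {n} (v : Fin (suc (suc n))) (w : Fin (suc n)) (M : Mat (suc (suc n))) →
    (∀ j → M v (punchIn v (punchIn w j)) ≈ 0#) → (∀ i → M (punchIn v (punchIn w i)) v ≈ 0#) →
    Det M ≈ M v v * Det (minor v v M) -
            (M v (punchIn v w) * M (punchIn v w) v) * Det (minor w w (minor v v M))
  det-leaf {n} v w M row≈0 col≈0 = begin
    Det M
      ≈⟨ det-row-+ v {M} {M₁} {M₂} split
           (λ i i≢v j → sym (minimal₁ i≢v j)) (λ i i≢v j → sym (minimal₂ i≢v j)) ⟩
    Det M₁ + Det M₂
      ≈⟨ +-cong det₁ det₂ ⟩
    M v v * Det (minor v v M) + - (M v w′ * M w′ v * D)
      ∎
    where
    w′ = punchIn v w
    v′ = swap v w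
    D  = Det (minor w w (minor v v M))
    N₁ N₂ : Fin (suc (suc n)) → Carrier
    N₁ = updateAt (λ _ → 0#) v (λ _ → M v v)
    N₂ = updateAt (M v) v (λ _ → 0#)
    M₁ M₂ : Mat (suc (suc n))
    M₁ = updateAt M v (λ _ → N₁)
    M₂ = updateAt M v (λ _ → N₂)
    row₁ : ∀ j → M₁ v j ≈ N₁ j
    row₁ j = reflexive (≡.cong (λ f → f j) (updateAt-updates v M))
    row₂ : ∀ j → M₂ v j ≈ N₂ j
    row₂ j = reflexive (≡.cong (λ f → f j) (updateAt-updates v M))
    minimal₁ : ∀ {i} → i ≢ v → ∀ j → M₁ i j ≈ M i j
    minimal₁ {i} i≢v j = reflexive (≡.cong (λ f → f j) (updateAt-minimal i v M i≢v))
    minimal₂ : ∀ {i} → i ≢ v → ∀ j → M₂ i j ≈ M i j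
    minimal₂ {i} i≢v j = reflexive (≡.cong (λ f → f j) (updateAt-minimal i v M i≢v))
    N₁-v : N₁ v ≈ M v v
    N₁-v = reflexive (updateAt-updates v (λ _ → 0#))
    N₂-v : N₂ v ≈ 0#
    N₂-v = reflexive (updateAt-updates v (M v))
    N₁-≢ : ∀ j → N₁ (punchIn v j) ≈ 0#
    N₁-≢ j = reflexive (updateAt-minimal (punchIn v j) v (λ _ → 0#) (Fin.punchInᵢ≢i v j))
    N₂-≢ : ∀ j → N₂ (punchIn v j) ≈ M v (punchIn v j)
    N₂-≢ j = reflexive (updateAt-minimal (punchIn v j) v (M v) (Fin.punchInᵢ≢i v j))
    N₂≈0 : ∀ j → N₂ (punchIn w′ j) ≈ 0#
    N₂≈0 j with punchIn-split v′ j
    ... | inj₁ ≡.refl       = trans (reflexive (≡.cong N₂ (punchIn-swap v w))) N₂-v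
    ... | inj₂ (k , ≡.refl) = trans (reflexive (≡.cong N₂ (punchIn-punchIn v w k))) (trans (N₂-≢ _) (row≈0 k))
    split : ∀ j → M v j ≈ M₁ v j + M₂ v j
    split j with punchIn-split v j
    ... | inj₁ ≡.refl       = sym (trans (+-cong (trans (row₁ v) N₁-v) (trans (row₂ v) N₂-v)) (+-identityʳ _))
    ... | inj₂ (k , ≡.refl) = sym (trans (+-cong (trans (row₁ _) (N₁-≢ k)) (trans (row₂ _) (N₂-≢ k))) (+-identityˡ _))
    det₁ : Det M₁ ≈ M v v * Det (minor v v M)
    det₁ = trans (det-isolated v M₁ (λ j → trans (row₁ _) (N₁-≢ j)))
      (*-cong (trans (row₁ v) N₁-v) (det-cong {N = minor v v M} λ i j → minimal₁ (Fin.punchInᵢ≢i v i) (punchIn v j)))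
    P : Mat (suc n)
    P = minor v w′ M
    detP : Det P ≈ (sgn w * sgn v′) * (M w′ v * D)
    detP = trans
      (det-single w v′ P (inj₂ λ i → trans (reflexive (≡.cong (M _) (punchIn-swap v w))) (col≈0 i)))
      (*-congˡ {sgn w * sgn v′} (*-cong (reflexive (≡.cong (M w′) (punchIn-swap v w)))
        (det-cong λ i j → reflexive (≡.cong (M _) (punchIn-punchIn v w j)))))
    det₂ : Det M₂ ≈ - (M v w′ * M w′ v * D)
    det₂ = begin
      Det M₂
        ≈⟨ det-single v w′ M₂ (inj₁ λ j → trans (row₂ _) (N₂≈0 j)) ⟩
      (sgn v * sgn w′) * (M₂ v w′ * Det (minor v w′ M₂))
        ≈⟨ *-congˡ (*-cong (trans (row₂ w′) (N₂-≢ w))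
             (trans (det-cong {N = P} λ i j → minimal₂ (Fin.punchInᵢ≢i v i) (punchIn w′ j)) detP)) ⟩
      (sgn v * sgn w′) * (M v w′ * ((sgn w * sgn v′) * (M w′ v * D)))
        ≈⟨ solve 7 (λ sv sw′ a sw sv′ b D → (sv :* sw′) :* (a :* ((sw :* sv′) :* (b :* D))) :=
                      (sw′ :* sv′) :* ((sv :* sw) :* (a :* b :* D)))
             refl (sgn v) (sgn w′) (M v w′) (sgn w) (sgn v′) (M w′ v) D ⟩
      (sgn w′ * sgn v′) * ((sgn v * sgn w) * (M v w′ * M w′ v * D))
        -- The four signs reduce to minus a square of signs: this is the minus sign of the
        -- recursion.
        ≈⟨ *-congʳ (sgn-swap v w) ⟩
      - (sgn v * sgn w) * ((sgn v * sgn w) * (M v w′ * M w′ v * D))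
        ≈⟨ solve 3 (λ sv sw x → :- (sv :* sw) :* ((sv :* sw) :* x) := (sv :* sv) :* ((sw :* sw) :* (:- x)))
             refl (sgn v) (sgn w) (M v w′ * M w′ v * D) ⟩
      (sgn v * sgn v) * ((sgn w * sgn w) * - (M v w′ * M w′ v * D))
        ≈⟨ *-cong (sgn-sgn v) (*-congʳ (sgn-sgn w)) ⟩
      1# * (1# * - (M v w′ * M w′ v * D))
        ≈⟨ trans (*-identityˡ _) (*-identityˡ _) ⟩
      - (M v w′ * M w′ v * D) ∎

-- Estimates for rational numbers

module Rationals where

  open +-*-Solver
  open ℚ.≤-Reasoning

  ½*-pos : ∀ {ε} → 0ℚ ℚ.< ε → 0ℚ ℚ.< ½ ℚ.* ε
  ½*-pos {ε} 0<ε = ℚ.positive⁻¹ (½ ℚ.* ε) {{ℚ.pos*pos⇒pos ½ ε {{positive 0<ε}}}}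

  ½+½ : ∀ ε → ½ ℚ.* ε ℚ.+ ½ ℚ.* ε ≡ ε
  ½+½ ε = ≡.trans (≡.sym (ℚ.*-distribʳ-+ ε ½ ½)) (ℚ.*-identityˡ ε)

  p≤∣p∣ : ∀ p → p ℚ.≤ ℚ.∣ p ∣
  p≤∣p∣ p with ℚ.≤-total 0ℚ p
  ... | inj₁ 0≤p = ℚ.≤-reflexive (≡.sym (ℚ.0≤p⇒∣p∣≡p 0≤p))
  ... | inj₂ p≤0 = ℚ.≤-trans p≤0 (ℚ.0≤∣p∣ p)

  ∣p∣≤ : ∀ {p ε} → p ℚ.≤ ε → ℚ.- p ℚ.≤ ε → ℚ.∣ p ∣ ℚ.≤ ε
  ∣p∣≤ {p} p≤ε -p≤ε with ℚ.∣p∣≡p∨∣p∣≡-p p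
  ... | inj₁ eq = ≡.subst (ℚ._≤ _) (≡.sym eq) p≤ε
  ... | inj₂ eq = ≡.subst (ℚ._≤ _) (≡.sym eq) -p≤ε

  p-q≤r⇒p≤q+r : ∀ p q {r} → p ℚ.- q ℚ.≤ r → p ℚ.≤ q ℚ.+ r
  p-q≤r⇒p≤q+r p q {r} h = begin
    p                 ≡⟨ solve 2 (λ p q → p := q :+ (p :- q)) ≡.refl p q ⟩
    q ℚ.+ (p ℚ.- q)   ≤⟨ ℚ.+-monoʳ-≤ q h ⟩
    q ℚ.+ r           ∎

  p≤q+r⇒p-q≤r : ∀ p q r → p ℚ.≤ q ℚ.+ r → p ℚ.- q ℚ.≤ r
  p≤q+r⇒p-q≤r p q r h = begin
    p ℚ.- q           ≤⟨ ℚ.+-monoˡ-≤ (ℚ.- q) h ⟩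
    (q ℚ.+ r) ℚ.- q   ≡⟨ solve 2 (λ q r → q :+ r :- q := r) ≡.refl q r ⟩
    r                 ∎

  -[p-q] : ∀ p q → ℚ.- (p ℚ.- q) ≡ q ℚ.- p
  -[p-q] = solve 2 (λ p q → :- (p :- q) := q :- p) ≡.refl

  ∣p-q∣≤r⇒p≤q+r : ∀ p q {r} → ℚ.∣ p ℚ.- q ∣ ℚ.≤ r → p ℚ.≤ q ℚ.+ r
  ∣p-q∣≤r⇒p≤q+r p q h = p-q≤r⇒p≤q+r p q (ℚ.≤-trans (p≤∣p∣ (p ℚ.- q)) h)

  ∣p-q∣≡∣q-p∣ : ∀ p q → ℚ.∣ p ℚ.- q ∣ ≡ ℚ.∣ q ℚ.- p ∣
  ∣p-q∣≡∣q-p∣ p q = ≡.trans (≡.sym (ℚ.∣-p∣≡∣p∣ (p ℚ.- q))) (≡.cong ℚ.∣_∣ (-[p-q] p q))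

  ∣p-q∣≤ : ∀ p q {r} → p ℚ.≤ q ℚ.+ r → q ℚ.≤ p ℚ.+ r → ℚ.∣ p ℚ.- q ∣ ℚ.≤ r
  ∣p-q∣≤ p q {r} h k =
    ∣p∣≤ (p≤q+r⇒p-q≤r p q r h) (≡.subst (ℚ._≤ r) (≡.sym (-[p-q] p q)) (p≤q+r⇒p-q≤r q p r k))

  ∣p∣-∣q∣≤∣p-q∣ : ∀ p q → ℚ.∣ p ∣ ℚ.- ℚ.∣ q ∣ ℚ.≤ ℚ.∣ p ℚ.- q ∣
  ∣p∣-∣q∣≤∣p-q∣ p q = p≤q+r⇒p-q≤r ℚ.∣ p ∣ ℚ.∣ q ∣ ℚ.∣ p ℚ.- q ∣ (begin
    ℚ.∣ p ∣                         ≡⟨ ≡.cong ℚ.∣_∣ (solve 2 (λ p q → p := q :+ (p :- q)) ≡.refl p q) ⟩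
    ℚ.∣ q ℚ.+ (p ℚ.- q) ∣           ≤⟨ ℚ.∣p+q∣≤∣p∣+∣q∣ q (p ℚ.- q) ⟩
    ℚ.∣ q ∣ ℚ.+ ℚ.∣ p ℚ.- q ∣       ∎)

  ∣∣p∣-∣q∣∣≤∣p-q∣ : ∀ p q → ℚ.∣ ℚ.∣ p ∣ ℚ.- ℚ.∣ q ∣ ∣ ℚ.≤ ℚ.∣ p ℚ.- q ∣
  ∣∣p∣-∣q∣∣≤∣p-q∣ p q = ∣p∣≤ (∣p∣-∣q∣≤∣p-q∣ p q) (begin
    ℚ.- (ℚ.∣ p ∣ ℚ.- ℚ.∣ q ∣)  ≡⟨ -[p-q] ℚ.∣ p ∣ ℚ.∣ q ∣ ⟩
    ℚ.∣ q ∣ ℚ.- ℚ.∣ p ∣        ≤⟨ ∣p∣-∣q∣≤∣p-q∣ q p ⟩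
    ℚ.∣ q ℚ.- p ∣              ≡⟨ ∣p-q∣≡∣q-p∣ q p ⟩
    ℚ.∣ p ℚ.- q ∣              ∎)

  ∣p∣*∣p∣≡p*p : ∀ p → ℚ.∣ p ∣ ℚ.* ℚ.∣ p ∣ ≡ p ℚ.* p
  ∣p∣*∣p∣≡p*p p with ℚ.∣p∣≡p∨∣p∣≡-p p
  ... | inj₁ eq = ≡.cong₂ ℚ._*_ eq eq
  ... | inj₂ eq = ≡.trans (≡.cong₂ ℚ._*_ eq eq) (solve 1 (λ p → :- p :* :- p := p :* p) ≡.refl p)

  *-mono-≤ : ∀ {p q r s} → 0ℚ ℚ.≤ p → 0ℚ ℚ.≤ s → p ℚ.≤ q → r ℚ.≤ s → p ℚ.* r ℚ.≤ q ℚ.* s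
  *-mono-≤ {p} {q} {r} {s} 0≤p 0≤s p≤q r≤s = ℚ.≤-trans
    (ℚ.*-monoˡ-≤-nonNeg p {{nonNegative 0≤p}} r≤s) (ℚ.*-monoʳ-≤-nonNeg s {{nonNegative 0≤s}} p≤q)

  quotient : ∀ {b ε} → 0ℚ ℚ.< b → 0ℚ ℚ.< ε → ∃[ δ ] (0ℚ ℚ.< δ × b ℚ.* δ ≡ ε)
  quotient {b} {ε} 0<b 0<ε =
    ℚ.1/ b ℚ.* ε ,
    ℚ.positive⁻¹ (ℚ.1/ b ℚ.* ε) {{ℚ.pos*pos⇒pos (ℚ.1/ b) {{ℚ.1/pos⇒pos b}} ε {{positive 0<ε}}}} ,
    ≡.trans (≡.sym (ℚ.*-assoc b (ℚ.1/ b) ε)) (≡.trans (≡.cong (ℚ._* ε) (ℚ.*-inverseʳ b)) (ℚ.*-identityˡ ε))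
    where
    instance
      b-pos : Positive b
      b-pos = positive 0<b
      b-nonZero : ℚ.NonZero b
      b-nonZero = ℚ.pos⇒nonZero b

-- The Cauchy reals as an ordered ring

module Reals where

  open import Defs

  open Rationals

  Eventually : (ℕ → Set) → Set
  Eventually P = ∃[ N ] (∀ n → N ℕ.≤ n → P n)

  infixl 4 _<$>_ _<*>_

  _<$>_ : {P Q : ℕ → Set} → (∀ {n} → P n → Q n) → Eventually P → Eventually Q
  f <$> (N , h) = N , λ n N≤n → f (h n N≤n)

  _<*>_ : {P Q : ℕ → Set} → Eventually (λ n → P n → Q n) → Eventually P → Eventually Q
  (M , f) <*> (N , h) = M ⊔ N , λ n p → f n (ℕ.m⊔n≤o⇒m≤o M N p) (h n (ℕ.m⊔n≤o⇒n≤o M N p))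

  never : ∀ {P} → Eventually P → (∀ n → ¬ P n) → ∀ {A : Set} → A
  never (N , h) ¬P = contradiction (h N ℕ.≤-refl) (¬P N)

  pointwise : ∀ {x y} → (∀ n → seq x n ≡ seq y n) → x ≈ y
  pointwise {x} {y} eq = mk≈ λ ε 0<ε → 0 , λ n _ →
    ≡.subst (λ z → ℚ.∣ z ℚ.- seq y n ∣ ℚ.≤ ε) (≡.sym (eq n))
      (≡.subst (ℚ._≤ ε) (≡.sym (≡.cong ℚ.∣_∣ (ℚ.+-inverseʳ (seq y n)))) (ℚ.<⇒≤ 0<ε))

  pointwise-≤ : ∀ {x y} → (∀ n → seq x n ℚ.≤ seq y n) → x ≤ y
  pointwise-≤ {x} {y} le = mk≤ λ ε 0<ε → 0 , λ n _ →
    ℚ.≤-trans (le n) (≡.subst (ℚ._≤ seq y n ℚ.+ ε) (ℚ.+-identityʳ (seq y n)) (ℚ.+-monoʳ-≤ (seq y n) (ℚ.<⇒≤ 0<ε)))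

  ≤-reflexive : ∀ {x y} → x ≈ y → x ≤ y
  ≤-reflexive {x} {y} x≈y = mk≤ λ ε 0<ε →
    (λ {n} → ∣p-q∣≤r⇒p≤q+r (seq x n) (seq y n)) <$> close x≈y ε 0<ε

  ≤-antisym : ∀ {x y} → x ≤ y → y ≤ x → x ≈ y
  ≤-antisym {x} {y} x≤y y≤x = mk≈ λ ε 0<ε →
    (λ {n} → ∣p-q∣≤ (seq x n) (seq y n)) <$> below x≤y ε 0<ε <*> below y≤x ε 0<ε

  ≤-trans : ∀ {x y z} → x ≤ y → y ≤ z → x ≤ z
  ≤-trans {x} {y} {z} x≤y y≤z = mk≤ λ ε 0<ε →
    (λ {n} → lemma ε (seq x n) (seq y n) (seq z n)) <$> below x≤y _ (½*-pos 0<ε) <*> below y≤z _ (½*-pos 0<ε)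
    where
    open ℚ.≤-Reasoning
    lemma : ∀ ε a b c → a ℚ.≤ b ℚ.+ ½ ℚ.* ε → b ℚ.≤ c ℚ.+ ½ ℚ.* ε → a ℚ.≤ c ℚ.+ ε
    lemma ε a b c h k = begin
      a                                   ≤⟨ h ⟩
      b ℚ.+ ½ ℚ.* ε                       ≤⟨ ℚ.+-monoˡ-≤ (½ ℚ.* ε) k ⟩
      (c ℚ.+ ½ ℚ.* ε) ℚ.+ ½ ℚ.* ε         ≡⟨ ℚ.+-assoc c (½ ℚ.* ε) (½ ℚ.* ε) ⟩
      c ℚ.+ (½ ℚ.* ε ℚ.+ ½ ℚ.* ε)         ≡⟨ ≡.cong (c ℚ.+_) (½+½ ε) ⟩
      c ℚ.+ ε                             ∎

  +-mono-≤ : ∀ {x y u v} → x ≤ y → u ≤ v → x + u ≤ y + v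
  +-mono-≤ {x} {y} {u} {v} x≤y u≤v = mk≤ λ ε 0<ε →
    (λ {n} → lemma ε (seq x n) (seq y n) (seq u n) (seq v n))
      <$> below x≤y _ (½*-pos 0<ε) <*> below u≤v _ (½*-pos 0<ε)
    where
    open ℚ.≤-Reasoning
    open +-*-Solver
    lemma : ∀ ε a b c d → a ℚ.≤ b ℚ.+ ½ ℚ.* ε → c ℚ.≤ d ℚ.+ ½ ℚ.* ε → a ℚ.+ c ℚ.≤ (b ℚ.+ d) ℚ.+ ε
    lemma ε a b c d h k = begin
      a ℚ.+ c                                       ≤⟨ ℚ.+-mono-≤ h k ⟩
      (b ℚ.+ ½ ℚ.* ε) ℚ.+ (d ℚ.+ ½ ℚ.* ε)
        ≡⟨ solve 3 (λ b d e → (b :+ e) :+ (d :+ e) := (b :+ d) :+ (e :+ e)) ≡.refl b d (½ ℚ.* ε) ⟩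
      (b ℚ.+ d) ℚ.+ (½ ℚ.* ε ℚ.+ ½ ℚ.* ε)           ≡⟨ ≡.cong ((b ℚ.+ d) ℚ.+_) (½+½ ε) ⟩
      (b ℚ.+ d) ℚ.+ ε                               ∎

  ≈-refl : ∀ {x} → x ≈ x
  ≈-refl = pointwise λ _ → ≡.refl

  ≈-sym : ∀ {x y} → x ≈ y → y ≈ x
  ≈-sym {x} {y} x≈y = mk≈ λ ε 0<ε →
    (λ {n} → ≡.subst (ℚ._≤ ε) (∣p-q∣≡∣q-p∣ (seq x n) (seq y n))) <$> close x≈y ε 0<ε

  ≈-trans : ∀ {x y z} → x ≈ y → y ≈ z → x ≈ z
  ≈-trans p q = ≤-antisym (≤-trans (≤-reflexive p) (≤-reflexive q))
                          (≤-trans (≤-reflexive (≈-sym q)) (≤-reflexive (≈-sym p)))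

  +-cong : ∀ {x y u v} → x ≈ y → u ≈ v → x + u ≈ y + v
  +-cong p q = ≤-antisym (+-mono-≤ (≤-reflexive p) (≤-reflexive q))
                         (+-mono-≤ (≤-reflexive (≈-sym p)) (≤-reflexive (≈-sym q)))

  -‿cong : ∀ {x y} → x ≈ y → - x ≈ - y
  -‿cong {x} {y} x≈y = mk≈ λ ε 0<ε →
    (λ {n} → ≡.subst (ℚ._≤ ε) (lemma (seq x n) (seq y n))) <$> close x≈y ε 0<ε
    where
    lemma : ∀ a b → ℚ.∣ a ℚ.- b ∣ ≡ ℚ.∣ ℚ.- a ℚ.- ℚ.- b ∣
    lemma a b = ≡.trans (≡.sym (ℚ.∣-p∣≡∣p∣ (a ℚ.- b))) (≡.cong ℚ.∣_∣ (ℚ.neg-distrib-+ a (ℚ.- b)))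

  abs-cong : ∀ {x y} → x ≈ y → abs x ≈ abs y
  abs-cong {x} {y} x≈y = mk≈ λ ε 0<ε →
    (λ {n} → ℚ.≤-trans (∣∣p∣-∣q∣∣≤∣p-q∣ (seq x n) (seq y n))) <$> close x≈y ε 0<ε

  *-congʳ : ∀ {x y} z → x ≈ y → x * z ≈ y * z
  *-congʳ {x} {y} z x≈y = mk≈ λ ε 0<ε →
    let B , N , 0<B , ≤B = cauchy-bounded (seq z) (cauchy z)
        δ , 0<δ , Bδ≡ε   = quotient 0<B 0<ε
    in (λ {n} → lemma ε B δ Bδ≡ε 0<B (seq x n) (seq y n) (seq z n)) <$> (N , ≤B) <*> close x≈y δ 0<δ
    where
    open ℚ.≤-Reasoning
    open +-*-Solver
    lemma : ∀ ε B δ → B ℚ.* δ ≡ ε → 0ℚ ℚ.< B → ∀ a b c → ℚ.∣ c ∣ ℚ.≤ B → ℚ.∣ a ℚ.- b ∣ ℚ.≤ δ →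
      ℚ.∣ a ℚ.* c ℚ.- b ℚ.* c ∣ ℚ.≤ ε
    lemma ε B δ eq 0<B a b c h k = begin
      ℚ.∣ a ℚ.* c ℚ.- b ℚ.* c ∣
        ≡⟨ ≡.cong ℚ.∣_∣ (solve 3 (λ a b c → a :* c :- b :* c := c :* (a :- b)) ≡.refl a b c) ⟩
      ℚ.∣ c ℚ.* (a ℚ.- b) ∣         ≡⟨ ℚ.∣p*q∣≡∣p∣*∣q∣ c (a ℚ.- b) ⟩
      ℚ.∣ c ∣ ℚ.* ℚ.∣ a ℚ.- b ∣     ≤⟨ *-mono-≤ (ℚ.0≤∣p∣ c) (ℚ.≤-trans (ℚ.0≤∣p∣ (a ℚ.- b)) k) h k ⟩
      B ℚ.* δ                       ≡⟨ eq ⟩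
      ε                             ∎

  *-comm : ∀ x y → x * y ≈ y * x
  *-comm x y = pointwise λ n → ℚ.*-comm (seq x n) (seq y n)

  *-cong : ∀ {x y u v} → x ≈ y → u ≈ v → x * u ≈ y * v
  *-cong {x} {y} {u} {v} p q =
    ≈-trans (*-congʳ u p) (≈-trans (*-comm y u) (≈-trans (*-congʳ y q) (*-comm v y)))

  ℝ-isCommutativeRing : IsCommutativeRing _≈_ _+_ _*_ -_ 0ℝ 1ℝ
  ℝ-isCommutativeRing = record
    { isRing = record
      { +-isAbelianGroup = record
        { isGroup = record
          { isMonoid = record
            { isSemigroup = record
              { isMagma = record
                { isEquivalence = record { refl = ≈-refl ; sym = ≈-sym ; trans = ≈-trans }
                ; ∙-cong = +-cong }
              ; assoc = λ x y z → pointwise λ n → ℚ.+-assoc (seq x n) (seq y n) (seq z n) }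
            ; identity = (λ x → pointwise λ n → ℚ.+-identityˡ (seq x n)) ,
                         (λ x → pointwise λ n → ℚ.+-identityʳ (seq x n)) }
          ; inverse = (λ x → pointwise λ n → ℚ.+-inverseˡ (seq x n)) ,
                      (λ x → pointwise λ n → ℚ.+-inverseʳ (seq x n))
          ; ⁻¹-cong = -‿cong }
        ; comm = λ x y → pointwise λ n → ℚ.+-comm (seq x n) (seq y n) }
      ; *-cong = *-cong
      ; *-assoc = λ x y z → pointwise λ n → ℚ.*-assoc (seq x n) (seq y n) (seq z n)
      ; *-identity = (λ x → pointwise λ n → ℚ.*-identityˡ (seq x n)) ,
                     (λ x → pointwise λ n → ℚ.*-identityʳ (seq x n))
      ; distrib = (λ x y z → pointwise λ n → ℚ.*-distribˡ-+ (seq x n) (seq y n) (seq z n)) ,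
                  (λ x y z → pointwise λ n → ℚ.*-distribʳ-+ (seq x n) (seq y n) (seq z n)) }
    ; *-comm = *-comm }

  -- Since x is Cauchy, one sufficiently late term decides whether x is nearly at most 0 or bounded away from it.
  dichotomy : ∀ x ε → 0ℚ ℚ.< ε →
    Eventually (λ n → seq x n ℚ.≤ ε) ⊎ ∃[ δ ] (0ℚ ℚ.< δ × Eventually (λ n → δ ℚ.≤ seq x n))
  -- A tolerance of ε/4 against the threshold ε/2: the later terms stay below 3ε/4 or above ε/4.
  dichotomy x ε 0<ε with cauchy x (½ ℚ.* (½ ℚ.* ε)) (½*-pos (½*-pos 0<ε))
  ... | N , h with seq x N ℚ.≤? ½ ℚ.* ε
  ...   | yes xN≤ = inj₁ (N , λ n N≤n → begin
    seq x n                                 ≤⟨ ∣p-q∣≤r⇒p≤q+r (seq x n) (seq x N) (h n N N≤n ℕ.≤-refl) ⟩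
    seq x N ℚ.+ ½ ℚ.* (½ ℚ.* ε)             ≤⟨ ℚ.+-mono-≤ xN≤ (half-≤ (ℚ.<⇒≤ (½*-pos 0<ε))) ⟩
    ½ ℚ.* ε ℚ.+ ½ ℚ.* ε                     ≡⟨ ½+½ ε ⟩
    ε                                       ∎)
    where
    open ℚ.≤-Reasoning
    half-≤ : ∀ {q} → 0ℚ ℚ.≤ q → ½ ℚ.* q ℚ.≤ q
    half-≤ {q} 0≤q = begin
      ½ ℚ.* q             ≡⟨ ℚ.+-identityʳ (½ ℚ.* q) ⟨
      ½ ℚ.* q ℚ.+ 0ℚ      ≤⟨ ℚ.+-monoʳ-≤ (½ ℚ.* q) (ℚ.nonNegative⁻¹ (½ ℚ.* q)
                               {{ℚ.nonNeg*nonNeg⇒nonNeg ½ q {{nonNegative 0≤q}}}}) ⟩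
      ½ ℚ.* q ℚ.+ ½ ℚ.* q ≡⟨ ½+½ q ⟩
      q                   ∎
  ...   | no xN≰ = inj₂ (½ ℚ.* (½ ℚ.* ε) , ½*-pos (½*-pos 0<ε) , N , λ n N≤n → begin
    ½ ℚ.* (½ ℚ.* ε)
      ≡⟨ solve 1 (λ q → q := (q :+ q) :- q) ≡.refl (½ ℚ.* (½ ℚ.* ε)) ⟩
    (½ ℚ.* (½ ℚ.* ε) ℚ.+ ½ ℚ.* (½ ℚ.* ε)) ℚ.- ½ ℚ.* (½ ℚ.* ε)
      ≡⟨ ≡.cong (ℚ._- ½ ℚ.* (½ ℚ.* ε)) (½+½ (½ ℚ.* ε)) ⟩
    ½ ℚ.* ε ℚ.- ½ ℚ.* (½ ℚ.* ε)
      ≤⟨ p≤q+r⇒p-q≤r (½ ℚ.* ε) (½ ℚ.* (½ ℚ.* ε)) (seq x n) (ℚ.≤-trans (ℚ.<⇒≤ (ℚ.≰⇒> xN≰))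
           (≡.subst (seq x N ℚ.≤_) (ℚ.+-comm (seq x n) (½ ℚ.* (½ ℚ.* ε)))
             (∣p-q∣≤r⇒p≤q+r (seq x N) (seq x n) (h N n ℕ.≤-refl N≤n)))) ⟩
    seq x n ∎)
    where
    open ℚ.≤-Reasoning
    open +-*-Solver

  -- For each ε the dichotomy for `x - y` yields either the estimate sought or a positive gap, so a
  -- gap may be assumed from the start. A gap refutes `x ≤ y` and proves `y ≤ x`; this is why `≤` is
  -- stable and total under a double negation.
  ≤-dichotomy : ∀ x y → (∃[ δ ] (0ℚ ℚ.< δ × Eventually (λ n → seq y n ℚ.+ δ ℚ.≤ seq x n)) → x ≤ y) → x ≤ y
  ≤-dichotomy x y h = mk≤ λ ε 0<ε → by-cases ε 0<ε (dichotomy (x - y) ε 0<ε)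
    where
    by-cases : ∀ ε → 0ℚ ℚ.< ε →
      Eventually (λ n → seq (x - y) n ℚ.≤ ε) ⊎ ∃[ δ ] (0ℚ ℚ.< δ × Eventually (λ n → δ ℚ.≤ seq (x - y) n)) →
      Eventually (λ n → seq x n ℚ.≤ seq y n ℚ.+ ε)
    by-cases ε 0<ε (inj₁ le)             = (λ {n} → p-q≤r⇒p≤q+r (seq x n) (seq y n)) <$> le
    by-cases ε 0<ε (inj₂ (δ , 0<δ , ge)) =
      below (h (δ , 0<δ , ((λ {n} → lemma (seq x n) (seq y n)) <$> ge))) ε 0<ε
      where
      open ℚ.≤-Reasoning
      open +-*-Solver
      lemma : ∀ a b → δ ℚ.≤ a ℚ.- b → b ℚ.+ δ ℚ.≤ a
      lemma a b k = begin
        b ℚ.+ δ             ≤⟨ ℚ.+-monoʳ-≤ b k ⟩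
        b ℚ.+ (a ℚ.- b)     ≡⟨ solve 2 (λ a b → b :+ (a :- b) := a) ≡.refl a b ⟩
        a                   ∎

  apart : ∀ {x y δ} → 0ℚ ℚ.< δ → Eventually (λ n → seq y n ℚ.+ δ ℚ.≤ seq x n) → ¬ (x ≤ y)
  apart {x} {y} {δ} 0<δ ge x≤y =
    never ((λ {n} → _,_) <$> ge <*> below x≤y _ (½*-pos 0<δ)) λ n (p , q) → lemma (seq y n) (ℚ.≤-trans p q)
    where
    lemma : ∀ b → ¬ (b ℚ.+ δ ℚ.≤ b ℚ.+ ½ ℚ.* δ)
    lemma b h = ℚ.<-irrefl ≡.refl (ℚ.<-≤-trans (≡.subst₂ ℚ._<_ (ℚ.+-identityʳ (½ ℚ.* δ)) (½+½ δ) (ℚ.+-monoʳ-< (½ ℚ.* δ) (½*-pos 0<δ)))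
      (≡.subst₂ ℚ._≤_ (cancel b δ) (cancel b (½ ℚ.* δ)) (ℚ.+-monoʳ-≤ (ℚ.- b) h)))
      where
      open +-*-Solver
      cancel : ∀ b d → ℚ.- b ℚ.+ (b ℚ.+ d) ≡ d
      cancel = solve 2 (λ b d → :- b :+ (b :+ d) := d) ≡.refl

  ≤-stable : ∀ {x y} → ¬ ¬ (x ≤ y) → x ≤ y
  ≤-stable {x} {y} ¬¬x≤y = ≤-dichotomy x y λ (δ , 0<δ , ge) → contradiction (apart 0<δ ge) ¬¬x≤y

  ≤-total : ∀ x y → ¬ ¬ (x ≤ y ⊎ y ≤ x)
  ≤-total x y k = k (inj₁ (≤-dichotomy x y λ (δ , 0<δ , ge) →
    contradiction (inj₂ (mk≤ λ ε 0<ε → (λ {n} → lemma (seq x n) (seq y n) 0<δ 0<ε) <$> ge)) k))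
    where
    open ℚ.≤-Reasoning
    lemma : ∀ {δ ε} a b → 0ℚ ℚ.< δ → 0ℚ ℚ.< ε → b ℚ.+ δ ℚ.≤ a → b ℚ.≤ a ℚ.+ ε
    lemma {δ} {ε} a b 0<δ 0<ε h = begin
      b           ≡⟨ ℚ.+-identityʳ b ⟨
      b ℚ.+ 0ℚ    ≤⟨ ℚ.+-monoʳ-≤ b (ℚ.<⇒≤ 0<δ) ⟩
      b ℚ.+ δ     ≤⟨ h ⟩
      a           ≡⟨ ℚ.+-identityʳ a ⟨
      a ℚ.+ 0ℚ    ≤⟨ ℚ.+-monoʳ-≤ a (ℚ.<⇒≤ 0<ε) ⟩
      a ℚ.+ ε     ∎

  0≤⇒abs≈ : ∀ {x} → 0ℝ ≤ x → abs x ≈ x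
  0≤⇒abs≈ {x} 0≤x = mk≈ λ ε 0<ε → (λ {n} → lemma ε 0<ε (seq x n)) <$> below 0≤x _ (½*-pos 0<ε)
    where
    open ℚ.≤-Reasoning
    open +-*-Solver
    lemma : ∀ ε → 0ℚ ℚ.< ε → ∀ a → 0ℚ ℚ.≤ a ℚ.+ ½ ℚ.* ε → ℚ.∣ ℚ.∣ a ∣ ℚ.- a ∣ ℚ.≤ ε
    lemma ε 0<ε a h with ℚ.∣p∣≡p∨∣p∣≡-p a
    ... | inj₁ eq = ≡.subst (ℚ._≤ ε) (≡.sym (≡.cong ℚ.∣_∣ (≡.trans (≡.cong (ℚ._- a) eq) (ℚ.+-inverseʳ a)))) (ℚ.<⇒≤ 0<ε)
    ... | inj₂ eq = begin
      ℚ.∣ ℚ.∣ a ∣ ℚ.- a ∣           ≡⟨ ℚ.0≤p⇒∣p∣≡p (≡.subst (ℚ._≤ ℚ.∣ a ∣ ℚ.- a) (ℚ.+-inverseʳ a)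
                                         (ℚ.+-monoˡ-≤ (ℚ.- a) (p≤∣p∣ a))) ⟩
      ℚ.∣ a ∣ ℚ.- a                 ≡⟨ ≡.cong (ℚ._- a) eq ⟩
      ℚ.- a ℚ.- a                   ≡⟨ ℚ.+-identityʳ (ℚ.- a ℚ.- a) ⟨
      (ℚ.- a ℚ.- a) ℚ.+ 0ℚ          ≤⟨ ℚ.+-monoʳ-≤ (ℚ.- a ℚ.- a) (ℚ.+-mono-≤ h h) ⟩
      (ℚ.- a ℚ.- a) ℚ.+ ((a ℚ.+ ½ ℚ.* ε) ℚ.+ (a ℚ.+ ½ ℚ.* ε))
        ≡⟨ solve 2 (λ a e → (:- a :- a) :+ ((a :+ e) :+ (a :+ e)) := e :+ e) ≡.refl a (½ ℚ.* ε) ⟩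
      ½ ℚ.* ε ℚ.+ ½ ℚ.* ε           ≡⟨ ½+½ ε ⟩
      ε                             ∎

  abs-* : ∀ x y → abs (x * y) ≈ abs x * abs y
  abs-* x y = pointwise λ n → ℚ.∣p*q∣≡∣p∣*∣q∣ (seq x n) (seq y n)

  0≤abs : ∀ x → 0ℝ ≤ abs x
  0≤abs x = pointwise-≤ λ n → ℚ.0≤∣p∣ (seq x n)

  -- Through absolute values, which are multiplicative on every approximation, so that no error
  -- terms have to be multiplied.
  *-nonNeg : ∀ {x y} → 0ℝ ≤ x → 0ℝ ≤ y → 0ℝ ≤ x * y
  *-nonNeg {x} {y} 0≤x 0≤y = ≤-trans {0ℝ} {abs (x * y)} {x * y} (0≤abs (x * y))
    (≤-reflexive (≈-trans {abs (x * y)} {abs x * abs y} {x * y} (abs-* x y)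
      (*-cong {abs x} {x} {abs y} {y} (0≤⇒abs≈ 0≤x) (0≤⇒abs≈ 0≤y))))

  ≈-stable : ∀ {x y} → ¬ ¬ (x ≈ y) → x ≈ y
  ≈-stable ¬¬x≈y = ≤-antisym (≤-stable λ k → ¬¬x≈y (k ∘ ≤-reflexive)) (≤-stable λ k → ¬¬x≈y (k ∘ ≤-reflexive ∘ ≈-sym))

  -- `x ≉ 0` alone gives no lower bound for the absolute value of `x`, so dividing is not possible.
  -- By stability `y ≉ 0` may be assumed. A lower bound for the absolute value of `x` would then
  -- force `y ≈ 0`, hence that absolute value is below every ε, contrary to `x ≉ 0`.
  *-cancel : ∀ {x y} → x * y ≈ 0ℝ → ¬ (x ≈ 0ℝ) → y ≈ 0ℝ
  *-cancel {x} {y} xy≈0 x≉0 = ≈-stable λ y≉0 → x≉0 (mk≈ λ ε 0<ε → by-cases y≉0 ε (dichotomy (abs x) ε 0<ε))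
    where
    open ℚ.≤-Reasoning
    strip : ∀ {ε} a → ℚ.∣ a ℚ.- 0ℚ ∣ ℚ.≤ ε → ℚ.∣ a ∣ ℚ.≤ ε
    strip {ε} a = ≡.subst (λ z → ℚ.∣ z ∣ ℚ.≤ ε) (ℚ.+-identityʳ a)
    unstrip : ∀ {ε} a → ℚ.∣ a ∣ ℚ.≤ ε → ℚ.∣ a ℚ.- 0ℚ ∣ ℚ.≤ ε
    unstrip {ε} a = ≡.subst (λ z → ℚ.∣ z ∣ ℚ.≤ ε) (≡.sym (ℚ.+-identityʳ a))
    lemma : ∀ ε δ → 0ℚ ℚ.< δ → ∀ a b → δ ℚ.≤ ℚ.∣ a ∣ → ℚ.∣ a ℚ.* b ℚ.- 0ℚ ∣ ℚ.≤ δ ℚ.* ε → ℚ.∣ b ℚ.- 0ℚ ∣ ℚ.≤ ε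
    lemma ε δ 0<δ a b h k = unstrip b (ℚ.*-cancelˡ-≤-pos δ {{positive 0<δ}} (begin
      δ ℚ.* ℚ.∣ b ∣           ≤⟨ ℚ.*-monoʳ-≤-nonNeg ℚ.∣ b ∣ {{ℚ.∣-∣-nonNeg b}} h ⟩
      ℚ.∣ a ∣ ℚ.* ℚ.∣ b ∣     ≡⟨ ℚ.∣p*q∣≡∣p∣*∣q∣ a b ⟨
      ℚ.∣ a ℚ.* b ∣           ≤⟨ strip (a ℚ.* b) k ⟩
      δ ℚ.* ε                 ∎))
    by-cases : ¬ (y ≈ 0ℝ) → ∀ ε →
      Eventually (λ n → ℚ.∣ seq x n ∣ ℚ.≤ ε) ⊎ ∃[ δ ] (0ℚ ℚ.< δ × Eventually (λ n → δ ℚ.≤ ℚ.∣ seq x n ∣)) →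
      Eventually (λ n → ℚ.∣ seq x n ℚ.- 0ℚ ∣ ℚ.≤ ε)
    by-cases y≉0 ε (inj₁ le)             = (λ {n} → unstrip (seq x n)) <$> le
    by-cases y≉0 ε (inj₂ (δ , 0<δ , ge)) = contradiction
      (mk≈ λ η 0<η → (λ {n} → lemma η δ 0<δ (seq x n) (seq y n)) <$> ge <*>
        close xy≈0 (δ ℚ.* η) (ℚ.positive⁻¹ (δ ℚ.* η) {{ℚ.pos*pos⇒pos δ {{positive 0<δ}} η {{positive 0<η}}}}))
      y≉0

-- What the argument uses about the real numbers; case distinctions are available under a double negation only.
record IsOrderedRing {C : Set} (_≈_ _≤_ : C → C → Set) (_+_ _*_ : C → C → C) (-_ abs : C → C) (0# 1# : C) : Set where
  field
    isCommutativeRing : IsCommutativeRing _≈_ _+_ _*_ -_ 0# 1#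
    ≤-reflexive : ∀ {x y} → x ≈ y → x ≤ y
    ≤-trans     : ∀ {x y z} → x ≤ y → y ≤ z → x ≤ z
    ≤-antisym   : ∀ {x y} → x ≤ y → y ≤ x → x ≈ y
    ≤-stable    : ∀ {x y} → ¬ ¬ (x ≤ y) → x ≤ y
    ≤-total     : ∀ x y → ¬ ¬ (x ≤ y ⊎ y ≤ x)
    +-mono-≤    : ∀ {x y u v} → x ≤ y → u ≤ v → (x + u) ≤ (y + v)
    *-nonNeg    : ∀ {x y} → 0# ≤ x → 0# ≤ y → 0# ≤ (x * y)
    *-cancel    : ∀ {x y} → (x * y) ≈ 0# → ¬ (x ≈ 0#) → y ≈ 0#
    1≰0         : ¬ (1# ≤ 0#)
    half        : C
    half+half   : (half + half) ≈ 1#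
    abs-cong    : ∀ {x y} → x ≈ y → abs x ≈ abs y
    abs-0       : abs 0# ≈ 0#
    abs-neg     : ∀ x → abs (- x) ≈ abs x
    abs-*       : ∀ x y → abs (x * y) ≈ (abs x * abs y)
    abs*abs     : ∀ x → (abs x * abs x) ≈ (x * x)
    0≤abs       : ∀ x → 0# ≤ abs x
    0≤⇒abs≈     : ∀ {x} → 0# ≤ x → abs x ≈ x

record OrderedRing : Set₁ where
  infix  4 _≈_ _≤_
  infixl 6 _+_
  infixl 7 _*_
  infix  8 -_
  field
    Carrier       : Set
    _≈_ _≤_       : Carrier → Carrier → Set
    _+_ _*_       : Carrier → Carrier → Carrier
    -_ abs        : Carrier → Carrier
    0# 1#         : Carrier
    isOrderedRing : IsOrderedRing _≈_ _≤_ _+_ _*_ -_ abs 0# 1#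
  open IsOrderedRing isOrderedRing public hiding (isCommutativeRing)

  commutativeRing : CommutativeRing 0ℓ 0ℓ
  commutativeRing = record { isCommutativeRing = IsOrderedRing.isCommutativeRing isOrderedRing }

  open CommutativeRing commutativeRing public hiding (zero; Carrier; _≈_; _+_; _*_; -_; 0#; 1#)

-- Arithmetic and inequalities in an ordered ring

module OrderedRings (O : OrderedRing) where

  open OrderedRing O
  open IntegerCoefficients commutativeRing using (ι; ι-suc; solve; _:=_; _:+_; _:*_; _:-_; :-_; con)
  open import Algebra.Properties.Semiring.Mult.TCOptimised semiring using (×-homo-+; ×1-homo-*)

  ≤-preorder : Preorder 0ℓ 0ℓ 0ℓ
  ≤-preorder = record
    { _≈_ = _≈_ ; _≲_ = _≤_
    ; isPreorder = record { isEquivalence = isEquivalence ; reflexive = ≤-reflexive ; trans = ≤-trans } }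

  open import Relation.Binary.Reasoning.Preorder ≤-preorder

  ≤-refl : ∀ {x} → x ≤ x
  ≤-refl = ≤-reflexive refl

  0≤1 : 0# ≤ 1#
  0≤1 = ≤-stable λ k → ≤-total 0# 1# λ { (inj₁ p) → k p ; (inj₂ q) → 1≰0 q }

  +-cancelʳ-≤ : ∀ {x y} z → x + z ≤ y + z → x ≤ y
  +-cancelʳ-≤ {x} {y} z h = begin
    x               ≈⟨ solve 2 (λ x z → x := x :+ z :- z) refl x z ⟩
    (x + z) - z     ≲⟨ +-mono-≤ h ≤-refl ⟩
    (y + z) - z     ≈⟨ solve 2 (λ y z → y :+ z :- z := y) refl y z ⟩
    y               ∎

  ≤⇒0≤- : ∀ {x y} → x ≤ y → 0# ≤ y - x
  ≤⇒0≤- {x} {y} h = begin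
    0#      ≈⟨ -‿inverseʳ x ⟨
    x - x   ≲⟨ +-mono-≤ h ≤-refl ⟩
    y - x   ∎

  0≤-⇒≤ : ∀ {x y} → 0# ≤ y - x → x ≤ y
  0≤-⇒≤ {x} {y} h = begin
    x            ≈⟨ +-identityˡ x ⟨
    0# + x       ≲⟨ +-mono-≤ h ≤-refl ⟩
    (y - x) + x  ≈⟨ solve 2 (λ x y → y :- x :+ x := y) refl x y ⟩
    y            ∎

  *-monoˡ-≤ : ∀ {z x y} → 0# ≤ z → x ≤ y → z * x ≤ z * y
  *-monoˡ-≤ {z} {x} {y} 0≤z x≤y = 0≤-⇒≤ (begin
    0#             ≲⟨ *-nonNeg 0≤z (≤⇒0≤- x≤y) ⟩
    z * (y - x)    ≈⟨ solve 3 (λ x y z → z :* (y :- x) := z :* y :- z :* x) refl x y z ⟩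
    z * y - z * x  ∎)

  1≤* : ∀ {x y} → 1# ≤ x → 1# ≤ y → 1# ≤ x * y
  1≤* {x} {y} 1≤x 1≤y = begin
    1#       ≲⟨ 1≤x ⟩
    x        ≈⟨ *-identityʳ x ⟨
    x * 1#   ≲⟨ *-monoˡ-≤ (≤-trans 0≤1 1≤x) 1≤y ⟩
    x * y    ∎

  ι-nonNeg : ∀ n → 0# ≤ ι n
  ι-nonNeg zero    = ≤-refl
  ι-nonNeg (suc n) = begin
    0#        ≈⟨ +-identityˡ 0# ⟨
    0# + 0#   ≲⟨ +-mono-≤ 0≤1 (ι-nonNeg n) ⟩
    1# + ι n  ≈⟨ ι-suc n ⟨
    ι (suc n) ∎

  ι-+ : ∀ m n → ι (m ℕ.+ n) ≈ ι m + ι n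
  ι-+ = ×-homo-+ 1#

  ι-* : ∀ m n → ι (m ℕ.* n) ≈ ι m * ι n
  ι-* = ×1-homo-*

  ι-mono-≤ : ∀ {m n} → m ℕ.≤ n → ι m ≤ ι n
  ι-mono-≤ {m} {n} m≤n = begin
    ι m                     ≈⟨ +-identityʳ _ ⟨
    ι m + 0#                ≲⟨ +-mono-≤ ≤-refl (ι-nonNeg (n ℕ.∸ m)) ⟩
    ι m + ι (n ℕ.∸ m)       ≈⟨ ι-+ m (n ℕ.∸ m) ⟨
    ι (m ℕ.+ (n ℕ.∸ m))     ≡⟨ ≡.cong ι (ℕ.m+[n∸m]≡n m≤n) ⟩
    ι n                     ∎

  -- The way back to the natural numbers, where the order is decidable: conclusions about `n` and
  -- `τ` leave the double negations here.
  ι-cancel-≤ : ∀ {m n} → ι m ≤ ι n → m ℕ.≤ n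
  ι-cancel-≤ {m} {n} h with m ℕ.≤? n
  ... | yes m≤n = m≤n
  ... | no  m≰n = contradiction (+-cancelʳ-≤ (ι n) (begin
    1# + ι n   ≈⟨ ι-suc n ⟨
    ι (suc n)  ≲⟨ ι-mono-≤ (ℕ.≰⇒> m≰n) ⟩
    ι m        ≲⟨ h ⟩
    ι n        ≈⟨ +-identityˡ _ ⟨
    0# + ι n   ∎)) 1≰0

  -- Sums and products of lists; the inequality of arithmetic and geometric means

  Σ Π : List Carrier → Carrier
  Σ = foldr _+_ 0#
  Π = foldr _*_ 1#

  ∣Σ∣ Σ² : List Carrier → Carrier
  ∣Σ∣ L = Σ (map abs L)
  Σ² L = Σ (map (λ x → x * x) L)

  NonNeg ≥1 ≤1 : Carrier → Set
  NonNeg x = 0# ≤ x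
  ≥1 x     = 1# ≤ x
  ≤1 x     = 0# ≤ x × x ≤ 1#

  length≤Σ : ∀ {L} → All ≥1 L → ι (length L) ≤ Σ L
  length≤Σ []             = ≤-refl
  length≤Σ {x ∷ L} (p ∷ ps) = ≤-trans (≤-reflexive (ι-suc (length L))) (+-mono-≤ p (length≤Σ ps))

  Π≤1 : ∀ {L} → All ≤1 L → Π L ≤ 1#
  Π≤1 []                       = ≤-refl
  Π≤1 {x ∷ L} ((p , q) ∷ ps) = begin
    x * Π L   ≲⟨ *-monoˡ-≤ p (Π≤1 ps) ⟩
    x * 1#    ≈⟨ *-identityʳ x ⟩
    x         ≲⟨ q ⟩
    1#        ∎

  xy+1≤x+y : ∀ {x y} → 1# ≤ x → y ≤ 1# → x * y + 1# ≤ x + y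
  xy+1≤x+y {x} {y} 1≤x y≤1 = 0≤-⇒≤ (begin
    0#                       ≲⟨ *-nonNeg (≤⇒0≤- 1≤x) (≤⇒0≤- y≤1) ⟩
    (x - 1#) * (1# - y)
      ≈⟨ solve 2 (λ x y → (x :- con (+ 1)) :* (con (+ 1) :- y) := (x :+ y) :- (x :* y :+ con (+ 1))) refl x y ⟩
    (x + y) - (x * y + 1#)   ∎)

  -- Replacing c and s by c * s and 1 preserves the product, and does not increase the sum if 1 lies between c and s.
  mutual
    am-gm′ : ∀ c B S → 0# ≤ c → All ≥1 B → All ≤1 S → 1# ≤ c * (Π B * Π S) →
      ι (suc (length B ℕ.+ length S)) ≤ c + (Σ B + Σ S)
    am-gm′ c B S 0≤c bs ss h = ≤-stable λ k → ≤-total c 1# λ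
      { (inj₁ c≤1) → k (am-gm-≤1 c B S 0≤c c≤1 bs ss h)
      ; (inj₂ 1≤c) → k (am-gm-≥1 c B S 1≤c bs ss h) }

    am-gm-≥1 : ∀ c B S → 1# ≤ c → All ≥1 B → All ≤1 S → 1# ≤ c * (Π B * Π S) →
      ι (suc (length B ℕ.+ length S)) ≤ c + (Σ B + Σ S)
    am-gm-≥1 c B [] 1≤c bs [] h = begin
      ι (suc (length B ℕ.+ 0))  ≡⟨ ≡.cong (ι ∘ suc) (ℕ.+-identityʳ (length B)) ⟩
      ι (suc (length B))        ≲⟨ length≤Σ (1≤c ∷ bs) ⟩
      c + Σ B                   ≈⟨ +-congˡ (+-identityʳ _) ⟨
      c + (Σ B + 0#)            ∎
    am-gm-≥1 c B (s ∷ S) 1≤c bs ((0≤s , s≤1) ∷ ss) h = begin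
      ι (suc (length B ℕ.+ suc (length S)))   ≡⟨ ≡.cong (ι ∘ suc) (ℕ.+-suc (length B) (length S)) ⟩
      ι (suc (suc (length B ℕ.+ length S)))   ≈⟨ ι-suc (suc (length B ℕ.+ length S)) ⟩
      1# + ι (suc (length B ℕ.+ length S))
        ≲⟨ +-mono-≤ ≤-refl (am-gm′ (c * s) B S (*-nonNeg (≤-trans 0≤1 1≤c) 0≤s) bs ss (begin
             1#                         ≲⟨ h ⟩
             c * (Π B * (s * Π S))      ≈⟨ solve 4 (λ c b s t → c :* (b :* (s :* t)) := (c :* s) :* (b :* t)) refl c (Π B) s (Π S) ⟩
             (c * s) * (Π B * Π S)      ∎)) ⟩
      1# + (c * s + (Σ B + Σ S))
        ≈⟨ solve 4 (λ c b s t → con (+ 1) :+ (c :* s :+ (b :+ t)) := (c :* s :+ con (+ 1)) :+ (b :+ t)) refl c (Σ B) s (Σ S) ⟩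
      (c * s + 1#) + (Σ B + Σ S)              ≲⟨ +-mono-≤ (xy+1≤x+y 1≤c s≤1) ≤-refl ⟩
      (c + s) + (Σ B + Σ S)
        ≈⟨ solve 4 (λ c b s t → (c :+ s) :+ (b :+ t) := c :+ (b :+ (s :+ t))) refl c (Σ B) s (Σ S) ⟩
      c + (Σ B + (s + Σ S))                   ∎

    am-gm-≤1 : ∀ c B S → 0# ≤ c → c ≤ 1# → All ≥1 B → All ≤1 S → 1# ≤ c * (Π B * Π S) →
      ι (suc (length B ℕ.+ length S)) ≤ c + (Σ B + Σ S)
    -- No large factor is left and the product of the small ones is at most 1, so `c` must be at
    -- least 1 after all.
    am-gm-≤1 c [] S 0≤c c≤1 [] ss h = am-gm-≥1 c [] S (begin
      1#                ≲⟨ h ⟩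
      c * (1# * Π S)    ≈⟨ *-congˡ (*-identityˡ _) ⟩
      c * Π S           ≲⟨ *-monoˡ-≤ 0≤c (Π≤1 ss) ⟩
      c * 1#            ≈⟨ *-identityʳ c ⟩
      c                 ∎) [] ss h
    am-gm-≤1 c (b ∷ B) S 0≤c c≤1 (1≤b ∷ bs) ss h = begin
      ι (suc (suc (length B ℕ.+ length S)))   ≈⟨ ι-suc (suc (length B ℕ.+ length S)) ⟩
      1# + ι (suc (length B ℕ.+ length S))
        ≲⟨ +-mono-≤ ≤-refl (am-gm′ (b * c) B S (*-nonNeg (≤-trans 0≤1 1≤b) 0≤c) bs ss (begin
             1#                         ≲⟨ h ⟩
             c * (b * Π B * Π S)        ≈⟨ solve 4 (λ c b s t → c :* (b :* s :* t) := (b :* c) :* (s :* t)) refl c b (Π B) (Π S) ⟩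
             (b * c) * (Π B * Π S)      ∎)) ⟩
      1# + (b * c + (Σ B + Σ S))
        ≈⟨ solve 4 (λ c b s t → con (+ 1) :+ (b :* c :+ (s :+ t)) := (b :* c :+ con (+ 1)) :+ (s :+ t)) refl c b (Σ B) (Σ S) ⟩
      (b * c + 1#) + (Σ B + Σ S)              ≲⟨ +-mono-≤ (xy+1≤x+y 1≤b c≤1) ≤-refl ⟩
      (b + c) + (Σ B + Σ S)
        ≈⟨ solve 4 (λ c b s t → (b :+ c) :+ (s :+ t) := c :+ (b :+ s :+ t)) refl c b (Σ B) (Σ S) ⟩
      c + (b + Σ B + Σ S)                     ∎

  -- Only product, sum and length enter the inequality, so these three are recorded instead of a
  -- permutation of `L`. The record is obtained under a double negation, since comparison with 1 is
  -- not decidable.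
  record Separated (L : List Carrier) : Set where
    field
      {large small} : List Carrier
      large-≥1      : All ≥1 large
      small-≤1      : All ≤1 small
      Π-≈           : Π large * Π small ≈ Π L
      Σ-≈           : Σ large + Σ small ≈ Σ L
      length-≡      : length large ℕ.+ length small ≡ length L

  separate : ∀ {L} → All NonNeg L → ¬ ¬ Separated L
  separate [] k = k record
    { large-≥1 = [] ; small-≤1 = [] ; Π-≈ = *-identityˡ 1# ; Σ-≈ = +-identityˡ 0# ; length-≡ = ≡.refl }
  separate {x ∷ L} (0≤x ∷ ps) k = separate ps λ s → let open Separated s in ≤-total x 1# λ
    { (inj₁ x≤1) → k record
        { large-≥1 = large-≥1 ; small-≤1 = (0≤x , x≤1) ∷ small-≤1
        ; Π-≈ = trans (solve 3 (λ a x b → a :* (x :* b) := x :* (a :* b)) refl (Π large) x (Π small)) (*-congˡ Π-≈)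
        ; Σ-≈ = trans (solve 3 (λ a x b → a :+ (x :+ b) := x :+ (a :+ b)) refl (Σ large) x (Σ small)) (+-congˡ Σ-≈)
        ; length-≡ = ≡.trans (ℕ.+-suc (length large) (length small)) (≡.cong suc length-≡) }
    ; (inj₂ 1≤x) → k record
        { large-≥1 = 1≤x ∷ large-≥1 ; small-≤1 = small-≤1
        ; Π-≈ = trans (*-assoc _ _ _) (*-congˡ Π-≈) ; Σ-≈ = trans (+-assoc _ _ _) (+-congˡ Σ-≈)
        ; length-≡ = ≡.cong suc length-≡ } }

  am-gm : ∀ {L} → All NonNeg L → 1# ≤ Π L → ι (length L) ≤ Σ L
  am-gm {L} ps 1≤Π = ≤-stable λ k → separate ps λ s → let open Separated s in k (+-cancelʳ-≤ 1# (begin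
    ι (length L) + 1#                          ≈⟨ trans (+-comm _ _) (sym (ι-suc (length L))) ⟩
    ι (suc (length L))                         ≡⟨ ≡.cong (ι ∘ suc) length-≡ ⟨
    ι (suc (length large ℕ.+ length small))
      -- The running factor starts as 1, which raises both the length and the sum by one; this
      -- surplus was added in order to be cancelled.
      ≲⟨ am-gm′ 1# large small 0≤1 large-≥1 small-≤1
           (≤-trans 1≤Π (≤-reflexive (trans (sym Π-≈) (sym (*-identityˡ _))))) ⟩
    1# + (Σ large + Σ small)                   ≈⟨ trans (+-comm _ _) (+-congʳ Σ-≈) ⟩
    Σ L + 1#                                   ∎))

  pairs : List Carrier → List Carrier
  pairs []      = []
  pairs (x ∷ L) = map (x *_) L ++ pairs L

  Σ-++ : ∀ L M → Σ (L ++ M) ≈ Σ L + Σ M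
  Σ-++ []      M = sym (+-identityˡ _)
  Σ-++ (x ∷ L) M = trans (+-congˡ (Σ-++ L M)) (sym (+-assoc _ _ _))

  Π-++ : ∀ L M → Π (L ++ M) ≈ Π L * Π M
  Π-++ []      M = sym (*-identityˡ _)
  Π-++ (x ∷ L) M = trans (*-congˡ (Π-++ L M)) (sym (*-assoc _ _ _))

  Σ-map-* : ∀ x L → Σ (map (x *_) L) ≈ x * Σ L
  Σ-map-* x []      = sym (zeroʳ x)
  Σ-map-* x (y ∷ L) = trans (+-congˡ (Σ-map-* x L)) (sym (distribˡ _ _ _))

  infixr 8 _^_
  _^_ : Carrier → ℕ → Carrier
  x ^ zero  = 1#
  x ^ suc n = x * x ^ n

  1≤^ : ∀ {x} → 1# ≤ x → ∀ n → 1# ≤ x ^ n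
  1≤^ 1≤x zero    = ≤-refl
  1≤^ 1≤x (suc n) = 1≤* 1≤x (1≤^ 1≤x n)

  *-^ : ∀ x y n → (x * y) ^ n ≈ x ^ n * y ^ n
  *-^ x y zero    = sym (*-identityˡ 1#)
  *-^ x y (suc n) = trans (*-congˡ (*-^ x y n))
    (solve 4 (λ x y a b → x :* y :* (a :* b) := x :* a :* (y :* b)) refl x y (x ^ n) (y ^ n))

  Π-map-* : ∀ x L → Π (map (x *_) L) ≈ x ^ length L * Π L
  Π-map-* x []      = sym (*-identityˡ 1#)
  Π-map-* x (y ∷ L) = trans (*-congˡ (Π-map-* x L))
    (solve 4 (λ x y a b → x :* y :* (a :* b) := x :* a :* (y :* b)) refl x y (x ^ length L) (Π L))

  -- Each of the `suc (length L)` entries occurs in exactly `length L` of the pairs. Hence a product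
  -- of at least 1 over the list gives one of at least 1 over the pairs, and `am-gm` applies to them
  -- as well.
  Π-pairs : ∀ x L → Π (pairs (x ∷ L)) ≈ Π (x ∷ L) ^ length L
  Π-pairs x []      = refl
  Π-pairs x (y ∷ L) = begin-equality
    Π (map (x *_) (y ∷ L) ++ pairs (y ∷ L))                       ≈⟨ Π-++ (map (x *_) (y ∷ L)) (pairs (y ∷ L)) ⟩
    Π (map (x *_) (y ∷ L)) * Π (pairs (y ∷ L))                    ≈⟨ *-cong (Π-map-* x (y ∷ L)) (Π-pairs y L) ⟩
    (x ^ suc (length L) * Π (y ∷ L)) * Π (y ∷ L) ^ length L       ≈⟨ *-assoc _ _ _ ⟩
    x ^ suc (length L) * Π (y ∷ L) ^ suc (length L)               ≈⟨ *-^ x (Π (y ∷ L)) (suc (length L)) ⟨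
    Π (x ∷ y ∷ L) ^ suc (length L)                                ∎

  pairs-nonNeg : ∀ {L} → All NonNeg L → All NonNeg (pairs L)
  pairs-nonNeg []                   = []
  pairs-nonNeg {x ∷ L} (0≤x ∷ ps) = All.++⁺ (products ps) (pairs-nonNeg ps)
    where
    products : ∀ {M} → All NonNeg M → All NonNeg (map (x *_) M)
    products []       = []
    products (q ∷ qs) = *-nonNeg 0≤x q ∷ products qs

  length≤Σ-pairs : ∀ {L} → All NonNeg L → 1# ≤ Π L → ι (length (pairs L)) ≤ Σ (pairs L)
  length≤Σ-pairs []                 _   = ≤-refl
  length≤Σ-pairs {x ∷ L} ps@(_ ∷ _) 1≤Π =
    am-gm (pairs-nonNeg ps) (≤-trans (1≤^ 1≤Π (length L)) (≤-reflexive (sym (Π-pairs x L))))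

  -- A square of cells consists of its diagonal and two mirror images of the set of pairs. The form
  -- matches `Σ*Σ` and avoids subtraction and division by 2.
  length-pairs : ∀ L → length L ℕ.+ 2 ℕ.* length (pairs L) ≡ length L ℕ.* length L
  length-pairs []      = ≡.refl
  length-pairs (x ∷ L) = ≡.trans
    (≡.cong (λ k → suc n ℕ.+ 2 ℕ.* k) (≡.trans (length-++ (map (x *_) L)) (≡.cong (ℕ._+ p) (length-map (x *_) L))))
    (≡.trans (solve′ 2 (λ n p → s (n ⊕ t (n ⊕ p)) ≔ s (n ⊕ (n ⊕ (n ⊕ t p)))) ≡.refl n p)
      (≡.trans (≡.cong (λ k → suc (n ℕ.+ (n ℕ.+ k))) (length-pairs L))
        (solve′ 1 (λ n → s (n ⊕ (n ⊕ n ⊗ n)) ≔ s n ⊗ s n) ≡.refl n)))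
    where
    open ℕ-Solver using () renaming (solve to solve′; _:+_ to _⊕_; _:*_ to _⊗_; _:=_ to _≔_; con to κ)
    n = length L
    p = length (pairs L)
    s = λ {k} (e : ℕ-Solver.Polynomial k) → κ 1 ⊕ e
    t = λ {k} (e : ℕ-Solver.Polynomial k) → κ 2 ⊗ e

  Σ*Σ : ∀ L → Σ L * Σ L ≈ Σ² L + (Σ (pairs L) + Σ (pairs L))
  Σ*Σ []      = trans (zeroˡ 0#) (sym (trans (+-identityˡ _) (+-identityˡ _)))
  Σ*Σ (x ∷ L) = begin-equality
    (x + Σ L) * (x + Σ L)
      ≈⟨ solve 2 (λ x s → (x :+ s) :* (x :+ s) := x :* x :+ (x :* s :+ x :* s :+ s :* s)) refl x (Σ L) ⟩
    x * x + (x * Σ L + x * Σ L + Σ L * Σ L)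
      ≈⟨ +-congˡ (+-congˡ (Σ*Σ L)) ⟩
    x * x + (x * Σ L + x * Σ L + (Σ² L + (Σ (pairs L) + Σ (pairs L))))
      ≈⟨ solve 4 (λ x s q p → x :* x :+ (x :* s :+ x :* s :+ (q :+ (p :+ p))) :=
                    (x :* x :+ q) :+ ((x :* s :+ p) :+ (x :* s :+ p))) refl x (Σ L) (Σ² L) (Σ (pairs L)) ⟩
    (x * x + Σ² L) + ((x * Σ L + Σ (pairs L)) + (x * Σ L + Σ (pairs L)))
      ≈⟨ +-congˡ (+-cong Σ-pairs Σ-pairs) ⟨
    (x * x + Σ² L) + (Σ (pairs (x ∷ L)) + Σ (pairs (x ∷ L))) ∎
    where
    Σ-pairs : Σ (pairs (x ∷ L)) ≈ x * Σ L + Σ (pairs L)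
    Σ-pairs = trans (Σ-++ (map (x *_) L) (pairs L)) (+-congʳ (Σ-map-* x L))

  -- The equality case of am-gm, in the form that is used: the inequality for the products of pairs bounds the
  -- mixed terms of (Σ L)² from below.
  Σ²≤length : ∀ {L} → All NonNeg L → 1# ≤ Π L → Σ L ≈ ι (length L) → Σ² L ≤ ι (length L)
  Σ²≤length {L} ps 1≤Π eq = +-cancelʳ-≤ (ι (2 ℕ.* length (pairs L))) (begin
    Σ² L + ι (2 ℕ.* length (pairs L))
      ≈⟨ +-congˡ (trans (ι-* 2 (length (pairs L))) (solve 1 (λ p → con (+ 2) :* p := p :+ p) refl (ι (length (pairs L))))) ⟩
    Σ² L + (ι (length (pairs L)) + ι (length (pairs L)))
      ≲⟨ +-mono-≤ ≤-refl (+-mono-≤ (length≤Σ-pairs ps 1≤Π) (length≤Σ-pairs ps 1≤Π)) ⟩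
    Σ² L + (Σ (pairs L) + Σ (pairs L))   ≈⟨ Σ*Σ L ⟨
    Σ L * Σ L                            ≈⟨ *-cong eq eq ⟩
    ι (length L) * ι (length L)          ≈⟨ ι-* (length L) (length L) ⟨
    ι (length L ℕ.* length L)            ≡⟨ ≡.cong ι (length-pairs L) ⟨
    ι (length L ℕ.+ 2 ℕ.* length (pairs L))  ≈⟨ ι-+ (length L) _ ⟩
    ι (length L) + ι (2 ℕ.* length (pairs L)) ∎)

-- Polynomials given by their values, and the coefficients of a product of linear factors

module Polynomials (O : OrderedRing) where

  open OrderedRing O
  open OrderedRings O
  open IntegerCoefficients commutativeRing using (ι; solve; _:=_; _:+_; _:*_; _:-_; :-_; con)
  open import Algebra.Properties.Ring ring using (x∙y⁻¹≈ε⇒x≈y; -0#≈0#)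
  open import Relation.Binary.Reasoning.Setoid setoid

  -- The value at x of the polynomial c₀ xⁿ + c₁ xⁿ⁻¹ + … + cₙ.
  ev : ℕ → (ℕ → Carrier) → Carrier → Carrier
  ev zero    c x = c 0
  ev (suc n) c x = x * ev n c x + c (suc n)

  ev-cong : ∀ n {c d} → (∀ j → c j ≈ d j) → ∀ x → ev n c x ≈ ev n d x
  ev-cong zero    c≈d x = c≈d 0
  ev-cong (suc n) c≈d x = +-cong (*-congˡ (ev-cong n c≈d x)) (c≈d (suc n))

  ev-- : ∀ n c d x → ev n (λ j → c j - d j) x ≈ ev n c x - ev n d x
  ev-- zero    c d x = refl
  ev-- (suc n) c d x = trans (+-congʳ (*-congˡ (ev-- n c d x)))
    (solve 5 (λ x a b p q → x :* (a :- b) :+ (p :- q) := (x :* a :+ p) :- (x :* b :+ q))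
      refl x (ev n c x) (ev n d x) (c (suc n)) (d (suc n)))

  ev-* : ∀ n a c x → ev n (λ j → a * c j) x ≈ a * ev n c x
  ev-* zero    a c x = refl
  ev-* (suc n) a c x = trans (+-congʳ (*-congˡ (ev-* n a c x)))
    (solve 4 (λ x a e p → x :* (a :* e) :+ a :* p := a :* (x :* e :+ p)) refl x a (ev n c x) (c (suc n)))

  -- Coefficients are aligned at the top, so a polynomial of lower degree appears with leading
  -- zeros; this brings polynomials of different degrees to a common one.
  ev-tail : ∀ n c x → c 0 ≈ 0# → ev (suc n) c x ≈ ev n (c ∘ suc) x
  ev-tail zero    c x c₀≈0 = trans (+-congʳ (trans (*-congˡ c₀≈0) (zeroʳ x))) (+-identityˡ _)
  ev-tail (suc n) c x c₀≈0 = +-congʳ (*-congˡ (ev-tail n c x c₀≈0))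

  ev-0 : ∀ n c x → (∀ j → j ℕ.≤ n → c j ≈ 0#) → ev n c x ≈ 0#
  ev-0 zero    c x h = h 0 z≤n
  ev-0 (suc n) c x h = trans
    (+-cong (trans (*-congˡ (ev-0 n c x λ j j≤n → h j (ℕ.m≤n⇒m≤1+n j≤n))) (zeroʳ x)) (h (suc n) ℕ.≤-refl))
    (+-identityˡ 0#)

  -- Recovers the leading coefficient from a value once the others are known to vanish.
  ev-1 : ∀ n c → (∀ j → j ℕ.< n → c (suc j) ≈ 0#) → ev n c 1# ≈ c 0
  ev-1 zero    c h = refl
  ev-1 (suc n) c h = trans (+-cong (trans (*-identityˡ _) (ev-1 n c λ j j<n → h j (ℕ.m<n⇒m<1+n j<n))) (h n ℕ.≤-refl))
    (+-identityʳ _)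

  pow2 : ℕ → Carrier
  pow2 j = ι (2 ℕ.^ j)

  pow2-suc : ∀ j → pow2 (suc j) ≈ (1# + 1#) * pow2 j
  pow2-suc j = ι-* 2 (2 ℕ.^ j)

  ev-scale : ∀ n c y → ev n (λ j → pow2 j * c j) ((1# + 1#) * y) ≈ pow2 n * ev n c y
  ev-scale zero    c y = refl
  ev-scale (suc n) c y = begin
    (1# + 1#) * y * ev n (λ j → pow2 j * c j) ((1# + 1#) * y) + pow2 (suc n) * c (suc n)
      ≈⟨ +-cong (*-congˡ (ev-scale n c y)) (*-congʳ (pow2-suc n)) ⟩
    (1# + 1#) * y * (pow2 n * ev n c y) + (1# + 1#) * pow2 n * c (suc n)
      ≈⟨ solve 5 (λ t y p e c → t :* y :* (p :* e) :+ t :* p :* c := t :* p :* (y :* e :+ c))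
           refl (1# + 1#) y (pow2 n) (ev n c y) (c (suc n)) ⟩
    (1# + 1#) * pow2 n * (y * ev n c y + c (suc n))
      ≈⟨ *-congʳ (pow2-suc n) ⟨
    pow2 (suc n) * ev (suc n) c y ∎

  pow2-1≉0 : ∀ j → ¬ (pow2 (suc j) - 1# ≈ 0#)
  pow2-1≉0 j eq = ℕ.<⇒≱ 1<2^ (ι-cancel-≤ (≤-reflexive (x∙y⁻¹≈ε⇒x≈y (pow2 (suc j)) 1# eq)))
    where
    1<2^ : 1 ℕ.< 2 ℕ.^ suc j
    1<2^ = ℕ.*-monoʳ-≤ 2 (ℕ.m^n>0 2 j)

  -- If p(x) = ∑ cⱼ xⁿ⁻ʲ vanishes everywhere, then so does 2ⁿ p(x / 2) - p(x) = ∑ (2ʲ - 1) cⱼ xⁿ⁻ʲ, which has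
  -- smaller degree.
  ev≈0⇒≈0 : ∀ n c → (∀ x → ev n c x ≈ 0#) → ∀ j → j ℕ.≤ n → c j ≈ 0#
  ev≈0⇒≈0 zero    c h zero z≤n = h 0#
  ev≈0⇒≈0 (suc n) c h = λ
    { zero    _         → trans (sym (ev-1 (suc n) c λ j j≤n → tail≈0 j (ℕ.s≤s⁻¹ j≤n))) (h 1#)
    ; (suc j) (s≤s j≤n) → tail≈0 j j≤n }
    where
    d : ℕ → Carrier
    d j = pow2 j * c j - c j
    d₀≈0 : d 0 ≈ 0#
    d₀≈0 = trans (+-congʳ (*-identityˡ _)) (-‿inverseʳ _)
    2*half : ∀ x → (1# + 1#) * (half * x) ≈ x
    2*half x = trans (solve 3 (λ a h x → (a :+ a) :* (h :* x) := a :* ((h :+ h) :* x)) refl 1# half x)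
      (trans (*-identityˡ _) (trans (*-congʳ half+half) (*-identityˡ x)))
    ev-arg : ∀ n c {x y} → x ≈ y → ev n c x ≈ ev n c y
    ev-arg zero    c x≈y = refl
    ev-arg (suc n) c x≈y = +-congʳ (*-cong x≈y (ev-arg n c x≈y))
    evd≈0 : ∀ x → ev (suc n) d x ≈ 0#
    evd≈0 x = begin
      ev (suc n) d x
        ≈⟨ ev-- (suc n) (λ j → pow2 j * c j) c x ⟩
      ev (suc n) (λ j → pow2 j * c j) x - ev (suc n) c x
        ≈⟨ +-cong (ev-arg (suc n) (λ j → pow2 j * c j) (sym (2*half x))) (-‿cong (h x)) ⟩
      ev (suc n) (λ j → pow2 j * c j) ((1# + 1#) * (half * x)) - 0#
        ≈⟨ +-cong (trans (ev-scale (suc n) c (half * x)) (trans (*-congˡ (h (half * x))) (zeroʳ _))) -0#≈0# ⟩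
      0# + 0#
        ≈⟨ +-identityˡ 0# ⟩
      0# ∎
    tail≈0 : ∀ j → j ℕ.≤ n → c (suc j) ≈ 0#
    tail≈0 j j≤n = *-cancel
      (trans (solve 2 (λ p c → (p :- con (+ 1)) :* c := p :* c :- c) refl (pow2 (suc j)) (c (suc j)))
        (ev≈0⇒≈0 n (d ∘ suc) (λ x → trans (sym (ev-tail n d x d₀≈0)) (evd≈0 x)) j j≤n))
      (pow2-1≉0 j)

  ev-injective : ∀ n c d → (∀ x → ev n c x ≈ ev n d x) → ∀ j → j ℕ.≤ n → c j ≈ d j
  ev-injective n c d h j j≤n = x∙y⁻¹≈ε⇒x≈y (c j) (d j) (ev≈0⇒≈0 n (λ j → c j - d j)
    (λ x → trans (ev-- n c d x) (trans (+-congʳ (h x)) (-‿inverseʳ _))) j j≤n)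

  -- Multiplication by `x - μ` on coefficient sequences. It is exact if `c` vanishes beyond index
  -- `n`; otherwise `ev-shift` has the remainder `c (suc n)`.
  shift : Carrier → (ℕ → Carrier) → ℕ → Carrier
  shift μ c zero    = c 0
  shift μ c (suc j) = c (suc j) - μ * c j

  ev-shift : ∀ n c μ x → ev (suc n) (shift μ c) x ≈ (x - μ) * ev n c x + c (suc n)
  ev-shift zero    c μ x = solve 4 (λ x a b μ → x :* a :+ (b :- μ :* a) := (x :- μ) :* a :+ b) refl x (c 0) (c 1) μ
  ev-shift (suc n) c μ x = trans (+-congʳ (*-congˡ (ev-shift n c μ x)))
    (solve 5 (λ x e a b μ → x :* ((x :- μ) :* e :+ a) :+ (b :- μ :* a) := (x :- μ) :* (x :* e :+ a) :+ b)
      refl x (ev n c x) (c (suc n)) (c (suc (suc n))) μ)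

  -- esym L j is the coefficient of x ^ (length L - j) in the product of the x - μ for μ in L.
  esym : List Carrier → ℕ → Carrier
  esym []      zero    = 1#
  esym []      (suc j) = 0#
  esym (μ ∷ L)         = shift μ (esym L)

  esym-0 : ∀ L → esym L 0 ≈ 1#
  esym-0 []      = refl
  esym-0 (μ ∷ L) = esym-0 L

  esym->length : ∀ L j → length L ℕ.< j → esym L j ≈ 0#
  esym->length []      (suc j) _       = refl
  esym->length (μ ∷ L) (suc j) (s≤s p) = begin
    esym L (suc j) - μ * esym L j   ≈⟨ +-cong (esym->length L (suc j) (ℕ.m<n⇒m<1+n p))
                                        (-‿cong (trans (*-congˡ (esym->length L j p)) (zeroʳ μ))) ⟩
    0# - 0#                         ≈⟨ -‿inverseʳ 0# ⟩
    0#                              ∎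

  abs-esym-length : ∀ L → abs (esym L (length L)) ≈ Π (map abs L)
  abs-esym-length []      = 0≤⇒abs≈ 0≤1
  abs-esym-length (μ ∷ L) = begin
    abs (esym L (suc (length L)) - μ * esym L (length L))
      ≈⟨ abs-cong (trans (+-congʳ (esym->length L _ ℕ.≤-refl)) (+-identityˡ _)) ⟩
    abs (- (μ * esym L (length L)))       ≈⟨ trans (abs-neg _) (abs-* _ _) ⟩
    abs μ * abs (esym L (length L))       ≈⟨ *-congˡ (abs-esym-length L) ⟩
    abs μ * Π (map abs L)                 ∎

  ev-esym : ∀ L x → ev (length L) (esym L) x ≈ Π (map (λ μ → x - μ) L)
  ev-esym []      x = refl
  ev-esym (μ ∷ L) x = begin
    ev (suc (length L)) (shift μ (esym L)) x
      ≈⟨ ev-shift (length L) (esym L) μ x ⟩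
    (x - μ) * ev (length L) (esym L) x + esym L (suc (length L))
      ≈⟨ trans (+-congˡ (esym->length L _ ℕ.≤-refl)) (+-identityʳ _) ⟩
    (x - μ) * ev (length L) (esym L) x   ≈⟨ *-congˡ (ev-esym L x) ⟩
    (x - μ) * Π (map (λ μ → x - μ) L)           ∎

  -- The identity p₂ = e₁² - 2e₂. Here `esym L j` carries the sign of (-1)ʲ, which disappears in the
  -- square of the first and is positive for the second.
  newton : ∀ L → Σ² L ≈ esym L 1 * esym L 1 - (esym L 2 + esym L 2)
  newton []      = solve 1 (λ z → con (+ 0) := con (+ 0) :* con (+ 0) :- (con (+ 0) :+ con (+ 0))) refl 0#
  newton (μ ∷ L) = begin
    μ * μ + Σ² L
      ≈⟨ +-congˡ (newton L) ⟩
    μ * μ + (e₁ * e₁ - (e₂ + e₂))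
      ≈⟨ solve 3 (λ μ a b → μ :* μ :+ (a :* a :- (b :+ b)) :=
           (a :- μ :* con (+ 1)) :* (a :- μ :* con (+ 1)) :- ((b :- μ :* a) :+ (b :- μ :* a))) refl μ e₁ e₂ ⟩
    (e₁ - μ * 1#) * (e₁ - μ * 1#) - ((e₂ - μ * e₁) + (e₂ - μ * e₁))
      ≈⟨ +-congʳ (*-cong e₁≈ e₁≈) ⟩
    esym (μ ∷ L) 1 * esym (μ ∷ L) 1 - (esym (μ ∷ L) 2 + esym (μ ∷ L) 2) ∎
    where
    e₁ = esym L 1
    e₂ = esym L 2
    e₁≈ : e₁ - μ * 1# ≈ esym (μ ∷ L) 1
    e₁≈ = +-congˡ (-‿cong (*-congˡ (sym (esym-0 L))))

  -- The coefficients of ∑ₖ (-1)ᵏ mₖ xⁿ⁻²ᵏ.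
  alternating : (ℕ → ℕ) → ℕ → Carrier
  alternating m zero          = ι (m 0)
  alternating m (suc zero)    = 0#
  alternating m (suc (suc j)) = - alternating (m ∘ suc) j

  abs-alternating : ∀ m k → abs (alternating m (k ℕ.+ k)) ≈ ι (m k)
  abs-alternating m zero    = 0≤⇒abs≈ (ι-nonNeg (m 0))
  abs-alternating m (suc k) = begin
    abs (alternating m (suc (k ℕ.+ suc k)))      ≡⟨ ≡.cong (λ i → abs (alternating m (suc i))) (ℕ.+-suc k k) ⟩
    abs (- alternating (m ∘ suc) (k ℕ.+ k))      ≈⟨ abs-neg _ ⟩
    abs (alternating (m ∘ suc) (k ℕ.+ k))        ≈⟨ abs-alternating (m ∘ suc) k ⟩
    ι (m (suc k))                                ∎

  -- One statement for both parities: for odd `j` the premise is vacuous and the coefficient is zero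
  -- anyway. It is applied at an index whose parity is not known.
  alternating-≈0 : ∀ m j → (∀ k → j ≡ k ℕ.+ k → m k ≡ 0) → alternating m j ≈ 0#
  alternating-≈0 m zero          h = reflexive (≡.cong ι (h 0 ≡.refl))
  alternating-≈0 m (suc zero)    h = refl
  alternating-≈0 m (suc (suc j)) h = trans
    (-‿cong (alternating-≈0 (m ∘ suc) j λ k eq →
      h (suc k) (≡.cong suc (≡.trans (≡.cong suc eq) (≡.sym (ℕ.+-suc k k)))))) -0#≈0#

  -- The eigenvalues that are not zero. Dropping a zero divides the polynomial by x, and this leaves
  -- coefficients counted from the top unchanged; hence `esym≈` holds at the same index on both
  -- sides although the lengths differ.
  record Support (M : List Carrier) : Set where
    field
      {list}  : List Carrier
      nonZero : All (λ x → ¬ (x ≈ 0#)) list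
      length≤ : length list ℕ.≤ length M
      esym≈   : ∀ j → esym M j ≈ esym list j
      ∣Σ∣≈    : ∣Σ∣ M ≈ ∣Σ∣ list
      Σ²≈     : Σ² M ≈ Σ² list

  support : ∀ M → ¬ ¬ Support M
  support [] k = k record { nonZero = [] ; length≤ = z≤n ; esym≈ = λ _ → refl ; ∣Σ∣≈ = refl ; Σ²≈ = refl }
  support (μ ∷ M) k = support M λ s → let open Support s in
    (λ (μ≉0 : ¬ (μ ≈ 0#)) → k record
      { nonZero = μ≉0 ∷ nonZero
      ; length≤ = s≤s length≤
      ; esym≈   = λ { zero → esym≈ 0 ; (suc j) → +-cong (esym≈ (suc j)) (-‿cong (*-congˡ (esym≈ j))) }
      ; ∣Σ∣≈    = +-congˡ ∣Σ∣≈
      ; Σ²≈     = +-congˡ Σ²≈ })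
    λ μ≈0 → k record
      { nonZero = nonZero
      ; length≤ = ℕ.m≤n⇒m≤1+n length≤
      ; esym≈   = λ { zero → esym≈ 0
                    ; (suc j) → trans (+-congˡ (trans (-‿cong (trans (*-congʳ μ≈0) (zeroˡ _))) -0#≈0#))
                                  (trans (+-identityʳ _) (esym≈ (suc j))) }
      ; ∣Σ∣≈    = trans (+-cong (trans (abs-cong μ≈0) abs-0) ∣Σ∣≈) (+-identityˡ _)
      ; Σ²≈     = trans (+-cong (trans (*-congʳ μ≈0) (zeroˡ _)) Σ²≈) (+-identityˡ _) }

  abs≈0⇒≈0 : ∀ {x} → abs x ≈ 0# → ¬ ¬ (x ≈ 0#)
  abs≈0⇒≈0 {x} eq x≉0 = x≉0 (*-cancel (trans (sym (abs*abs x)) (trans (*-congʳ eq) (zeroˡ _))) x≉0)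

  Π-nonZero : ∀ {L} → All (λ x → ¬ (x ≈ 0#)) L → ¬ (Π (map abs L) ≈ 0#)
  Π-nonZero []         eq = 1≰0 (≤-reflexive eq)
  Π-nonZero (μ≉0 ∷ ps) eq = Π-nonZero ps (*-cancel eq λ μ≈0 → abs≈0⇒≈0 μ≈0 μ≉0)

  module Spectrum (M : List Carrier) (m : ℕ → ℕ) (esym≈alternating : ∀ j → j ℕ.≤ length M → esym M j ≈ alternating m j) where

    Σ²-abs : ∀ L → Σ² (map abs L) ≈ Σ² L
    Σ²-abs []      = refl
    Σ²-abs (x ∷ L) = +-cong (abs*abs x) (Σ²-abs L)

    -- The trace of A², read off from the coefficients: index 1 contributes nothing, and index 2,
    -- available from length 2 on, contributes the number of edges.
    Σ²-M : 2 ℕ.≤ length M → Σ² M ≈ ι (m 1 ℕ.+ m 1)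
    Σ²-M 2≤ = begin
      Σ² M                                        ≈⟨ newton M ⟩
      esym M 1 * esym M 1 - (esym M 2 + esym M 2)
        ≈⟨ +-cong (*-cong e₁≈0 e₁≈0) (-‿cong (+-cong (esym≈alternating 2 2≤) (esym≈alternating 2 2≤))) ⟩
      0# * 0# - (- ι (m 1) + - ι (m 1))
        ≈⟨ solve 1 (λ a → con (+ 0) :* con (+ 0) :- (:- a :+ :- a) := a :+ a) refl (ι (m 1)) ⟩
      ι (m 1) + ι (m 1)                           ≈⟨ ι-+ (m 1) (m 1) ⟨
      ι (m 1 ℕ.+ m 1)                             ∎
      where
      e₁≈0 : esym M 1 ≈ 0#
      e₁≈0 = esym≈alternating 1 (ℕ.≤-trans (s≤s z≤n) 2≤)

    module _ (τ : ℕ) (τ+τ≤ : τ ℕ.+ τ ℕ.≤ length M) (1≤mτ : 1 ℕ.≤ m τ) (m≡0 : ∀ k → τ ℕ.< k → m k ≡ 0) where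

      -- With fewer than 2τ non-zero eigenvalues the coefficient at index 2τ would vanish, but its
      -- absolute value is `m τ`. With more, their product would be, up to sign, a coefficient
      -- beyond index 2τ and hence zero, but no factor is zero.
      length-support : (s : Support M) → length (Support.list s) ≡ τ ℕ.+ τ
      length-support s with ℕ.<-cmp (length (Support.list s)) (τ ℕ.+ τ)
      ... | tri≈ _ eq _ = eq
      ... | tri< lt _ _ = contradiction (ι-cancel-≤ (≤-reflexive (begin
        ι (m τ)                              ≈⟨ abs-alternating m τ ⟨
        abs (alternating m (τ ℕ.+ τ))        ≈⟨ abs-cong (esym≈alternating (τ ℕ.+ τ) τ+τ≤) ⟨
        abs (esym M (τ ℕ.+ τ))               ≈⟨ abs-cong (trans (esym≈ (τ ℕ.+ τ)) (esym->length list _ lt)) ⟩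
        abs 0#                               ≈⟨ abs-0 ⟩
        0#                                   ∎))) (ℕ.<⇒≱ 1≤mτ)
        where open Support s
      ... | tri> _ _ gt = contradiction (begin
        Π (map abs list)                     ≈⟨ abs-esym-length list ⟨
        abs (esym list (length list))        ≈⟨ abs-cong (esym≈ (length list)) ⟨
        abs (esym M (length list))           ≈⟨ abs-cong (esym≈alternating (length list) length≤) ⟩
        abs (alternating m (length list))    ≈⟨ abs-cong (alternating-≈0 m (length list) λ k eq → m≡0 k (half-< k eq)) ⟩
        abs 0#                               ≈⟨ abs-0 ⟩
        0#                                   ∎) (Π-nonZero nonZero)
        where
        open Support s
        half-< : ∀ k → length list ≡ k ℕ.+ k → τ ℕ.< k
        half-< k eq = ℕ.≰⇒> λ k≤τ → ℕ.<⇒≱ gt (≡.subst (ℕ._≤ τ ℕ.+ τ) (≡.sym eq) (ℕ.+-mono-≤ k≤τ k≤τ))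

      1≤Π-support : (s : Support M) → 1# ≤ Π (map abs (Support.list s))
      1≤Π-support s = ≤-trans (ι-mono-≤ 1≤mτ) (≤-reflexive (begin
        ι (m τ)                              ≈⟨ abs-alternating m τ ⟨
        abs (alternating m (τ ℕ.+ τ))        ≈⟨ abs-cong (esym≈alternating (τ ℕ.+ τ) τ+τ≤) ⟨
        abs (esym M (τ ℕ.+ τ))               ≈⟨ abs-cong (esym≈ (τ ℕ.+ τ)) ⟩
        abs (esym list (τ ℕ.+ τ))            ≡⟨ ≡.cong (abs ∘ esym list) (length-support s) ⟨
        abs (esym list (length list))        ≈⟨ abs-esym-length list ⟩
        Π (map abs list)                     ∎))
        where open Support s

      abs-nonNeg : ∀ L → All NonNeg (map abs L)
      abs-nonNeg []      = []
      abs-nonNeg (x ∷ L) = 0≤abs x ∷ abs-nonNeg L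

      length-abs : (s : Support M) → length (map abs (Support.list s)) ≡ τ ℕ.+ τ
      length-abs s = ≡.trans (length-map abs (Support.list s)) (length-support s)

      energy-≥ : ι (τ ℕ.+ τ) ≤ ∣Σ∣ M
      energy-≥ = ≤-stable λ k → support M λ s → k (≤-trans (≤-reflexive (reflexive (≡.cong ι (≡.sym (length-abs s)))))
        (≤-trans (am-gm (abs-nonNeg (Support.list s)) (1≤Π-support s)) (≤-reflexive (sym (Support.∣Σ∣≈ s)))))

      energy-≡ : 2 ℕ.≤ length M → ∣Σ∣ M ≈ ι (τ ℕ.+ τ) → m 1 ℕ.+ m 1 ℕ.≤ τ ℕ.+ τ
      energy-≡ 2≤ eq = ι-cancel-≤ (≤-stable λ k → support M λ s → let open Support s in k
        (≤-trans (≤-reflexive (trans (sym (Σ²-M 2≤)) (trans Σ²≈ (sym (Σ²-abs list)))))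
          (≤-trans (Σ²≤length (abs-nonNeg list) (1≤Π-support s)
              (trans (sym ∣Σ∣≈) (trans eq (reflexive (≡.cong ι (≡.sym (length-abs s)))))))
            (≤-reflexive (reflexive (≡.cong ι (length-abs s)))))))

  -- The two eigenvalues are not computed. Their absolute values have square sum 2m₁ and product m₁,
  -- so E² = 4m₁ ≤ 4. The lower bound 2 ≤ E replaces a square root: E + 2 ≤ 2E ≤ E² ≤ 2 + 2.
  ∣Σ∣≤2 : ∀ {a b} (m : ℕ → ℕ) → let M = a ∷ b ∷ [] in
    (∀ j → j ℕ.≤ 2 → esym M j ≈ alternating m j) → m 1 ℕ.≤ 1 → ι 2 ≤ ∣Σ∣ M → ∣Σ∣ M ≤ ι 2
  ∣Σ∣≤2 {a} {b} m h m≤1 2≤E = +-cancelʳ-≤ (ι 2) (≤-trans (+-mono-≤ (≤-refl {E}) 2≤E) (≤-trans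
    (≤-reflexive (solve 1 (λ e → e :+ e := e :* con (+ 2)) refl E)) (≤-trans
    (*-monoˡ-≤ (≤-trans (ι-nonNeg 2) 2≤E) 2≤E) (≤-trans (≤-reflexive E*E) (≤-trans
    (ι-mono-≤ (ℕ.+-mono-≤ (ℕ.+-mono-≤ m≤1 m≤1) (ℕ.+-mono-≤ m≤1 m≤1))) (≤-reflexive (ι-+ 2 2)))))))
    where
    M = a ∷ b ∷ []
    E = ∣Σ∣ M
    open Spectrum M m h
    Σ-pairs : Σ (pairs (map abs M)) ≈ ι (m 1)
    Σ-pairs = begin
      abs a * abs b + 0#          ≈⟨ +-identityʳ _ ⟩
      abs a * abs b               ≈⟨ *-congˡ (*-identityʳ _) ⟨
      Π (map abs M)               ≈⟨ abs-esym-length M ⟨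
      abs (esym M 2)              ≈⟨ abs-cong (h 2 ℕ.≤-refl) ⟩
      abs (alternating m 2)       ≈⟨ abs-alternating m 1 ⟩
      ι (m 1)                     ∎
    E*E : E * E ≈ ι ((m 1 ℕ.+ m 1) ℕ.+ (m 1 ℕ.+ m 1))
    E*E = begin
      E * E                                                   ≈⟨ Σ*Σ (map abs M) ⟩
      Σ² (map abs M) + (Σ (pairs (map abs M)) + Σ (pairs (map abs M)))
        ≈⟨ +-cong (trans (Σ²-abs M) (Σ²-M ℕ.≤-refl)) (trans (+-cong Σ-pairs Σ-pairs) (sym (ι-+ (m 1) (m 1)))) ⟩
      ι (m 1 ℕ.+ m 1) + ι (m 1 ℕ.+ m 1)                       ≈⟨ ι-+ (m 1 ℕ.+ m 1) (m 1 ℕ.+ m 1) ⟨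
      ι ((m 1 ℕ.+ m 1) ℕ.+ (m 1 ℕ.+ m 1))                     ∎

-- Forests have an isolated vertex or a leaf

module Lists {A : Set} {R : A → A → Set} where

  AllPairs-prefix : ∀ xs {y zs} → AllPairs R (xs ++ y ∷ zs) → AllPairs R (xs ∷ʳ y)
  AllPairs-prefix []       (_ ∷ _)  = [] ∷ []
  AllPairs-prefix (x ∷ xs) (p ∷ ps) with All.++⁻ xs p
  ... | before , at ∷ _ = All.++⁺ before (at ∷ []) ∷ AllPairs-prefix xs ps

  -- Cuts a path after `y` and steps from there to `z`; with `z` the first vertex of the path this
  -- closes a cycle.
  Linked-prefix : ∀ xs {y z zs} → Linked R (xs ++ y ∷ zs) → R y z → Linked R ((xs ∷ʳ y) ∷ʳ z)
  Linked-prefix []            _        r = r ∷ [-]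
  Linked-prefix (x ∷ [])      (p ∷ _)  r = p ∷ r ∷ [-]
  Linked-prefix (x ∷ y ∷ xs)  (p ∷ ps) r = p ∷ Linked-prefix (y ∷ xs) ps r

Unique⇒length≤ : ∀ {n} {xs : List (Fin n)} → Unique xs → length xs ℕ.≤ n
Unique⇒length≤ unique = Fin.injective⇒≤ (lookup-injective unique)
  where
  lookup-injective : ∀ {A : Set} {xs : List A} → Unique xs → ∀ {i j} → lookup xs i ≡ lookup xs j → i ≡ j
  lookup-injective (p ∷ ps) {zero}  {zero}  _  = ≡.refl
  lookup-injective (p ∷ ps) {zero}  {suc j} eq = contradiction eq (All.lookup p (∈-lookup j))
  lookup-injective (p ∷ ps) {suc i} {zero}  eq = contradiction (≡.sym eq) (All.lookup p (∈-lookup i))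
  lookup-injective (p ∷ ps) {suc i} {suc j} eq = ≡.cong suc (lookup-injective ps eq)

remove : ∀ {n} → Fin (suc n) → Graph (suc n) → Graph n
remove v G = record
  { Adj        = λ i j → Adj (punchIn v i) (punchIn v j)
  ; adj?       = λ i j → adj? (punchIn v i) (punchIn v j)
  ; adj-sym    = adj-sym
  ; adj-irrefl = adj-irrefl ∘ ≡.cong (punchIn v)
  }
  where open Graph G

Acyclic Connected : ∀ {n} → Graph n → Set
Acyclic G   = ¬ Cycle G
Connected G = ∀ i j → Star (Graph.Adj G) i j

remove-acyclic : ∀ {n} (v : Fin (suc n)) (G : Graph (suc n)) → Acyclic G → Acyclic (remove v G)
remove-acyclic v G acyclic c = acyclic record
  { start    = punchIn v start
  ; rest     = map (punchIn v) rest
  ; long     = ≡.subst (2 ℕ.≤_) (≡.sym (length-map (punchIn v) rest)) long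
  ; distinct = Unique.map⁺ (Fin.punchIn-injective v _ _) distinct
  ; walk     = ≡.subst (λ xs → Linked (Graph.Adj G) (punchIn v start ∷ xs)) (map-++ (punchIn v) rest _)
                 (Linked.map⁺ walk)
  }
  where open Cycle c

Isolated : ∀ {n} → Graph n → Fin n → Set
Isolated G v = ∀ j → ¬ Graph.Adj G v j

record LeafAt {n} (G : Graph n) (v w : Fin n) : Set where
  open Graph G
  field
    adjacent : Adj v w
    only     : ∀ j → Adj v j → j ≡ w

  only′ : ∀ j → Adj j v → j ≡ w
  only′ j = only j ∘ adj-sym

-- A path that cannot be prolonged without closing a cycle ends in a vertex of degree at most one.
isolated-or-leaf : ∀ {n} (G : Graph (suc n)) → Acyclic G → ∃ (Isolated G) ⊎ ∃[ v ] ∃[ w ] LeafAt G v w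
isolated-or-leaf {n} G acyclic = prolong (suc n) zero [] ([] ∷ []) [-] (ℕ.m≤m+n (suc n) 0)
  where
  open Graph G
  open Membership (Fin._≟_ {suc n}) using (_∈?_)
  -- The newest vertex `x` stands first. Each prolongation trades one unit of fuel for one vertex,
  -- so a path without fuel would have more distinct vertices than the graph.
  prolong : ∀ fuel x ys → Unique (x ∷ ys) → Linked Adj (x ∷ ys) → suc n ℕ.≤ fuel ℕ.+ length ys →
    ∃ (Isolated G) ⊎ ∃[ v ] ∃[ w ] LeafAt G v w
  prolong zero x ys unique _ n≤ = contradiction (ℕ.≤-trans (Unique⇒length≤ unique) n≤) ℕ.1+n≰n
  prolong (suc fuel) x [] unique linked n≤ with Fin.any? (adj? x)
  ... | no ¬∃         = inj₁ (x , λ j x~j → ¬∃ (j , x~j))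
  ... | yes (y , x~y) = prolong fuel y (x ∷ [])
    (((λ y≡x → adj-irrefl (≡.sym y≡x) x~y) ∷ []) ∷ unique) (adj-sym x~y ∷ linked)
    (≡.subst (suc n ℕ.≤_) (≡.sym (ℕ.+-suc fuel 0)) n≤)
  prolong (suc fuel) x (z ∷ zs) unique linked@(x~z ∷ _) n≤
    with Fin.any? (λ y → adj? x y ×-dec ¬? (y Fin.≟ z))
  ... | no ¬∃ = inj₂ (x , z , record
    { adjacent = x~z ; only = λ j x~j → decidable-stable (j Fin.≟ z) λ j≢z → ¬∃ (j , x~j , j≢z) })
  ... | yes (y , x~y , y≢z) with y ∈? zs
  ...   | no y∉zs = prolong fuel y (x ∷ z ∷ zs)
    (((λ y≡x → adj-irrefl (≡.sym y≡x) x~y) ∷ y≢z ∷ All.¬Any⇒All¬ zs y∉zs) ∷ unique) (adj-sym x~y ∷ linked)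
    (≡.subst (suc n ℕ.≤_) (≡.sym (ℕ.+-suc fuel (suc (length zs)))) n≤)
  -- The edge from `x` to an earlier vertex `y` closes the path between them. As `y` differs from
  -- `z`, at least two vertices besides `x` lie on this cycle.
  ...   | yes y∈zs with ∈-∃++ y∈zs
  ...     | pre , post , ≡.refl = contradiction record
    { start    = x
    ; rest     = z ∷ (pre ∷ʳ y)
    ; long     = s≤s (≡.subst (1 ℕ.≤_) (≡.sym (length-++ pre)) (ℕ.m≤n+m 1 (length pre)))
    ; distinct = Lists.AllPairs-prefix (x ∷ z ∷ pre) unique
    ; walk     = Lists.Linked-prefix (x ∷ z ∷ pre) linked (adj-sym x~y)
    } acyclic

-- Connectedness and vertex covers under the removal of a vertex

isolated-connected : ∀ {n} (G : Graph (suc n)) v → Isolated G v → Connected G → n ≡ 0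
isolated-connected {zero}  G v isolated connected = ≡.refl
isolated-connected {suc n} G v isolated connected =
  contradiction (connected v (punchIn v zero)) (no-walk (Fin.punchInᵢ≢i v zero ∘ ≡.sym))
  where
  no-walk : ∀ {j} → v ≢ j → ¬ Star (Graph.Adj G) v j
  no-walk v≢j Star.ε         = v≢j ≡.refl
  no-walk v≢j (v~k ◅ _) = isolated _ v~k

leaf-connected : ∀ {n} (G : Graph (suc n)) v w → LeafAt G v (punchIn v w) → Connected G → Connected (remove v G)
leaf-connected G v w leaf connected i j = retract (inj₁ ≡.refl) (inj₁ ≡.refl) (connected (punchIn v i) (punchIn v j))
  where
  open Graph G
  open LeafAt leaf
  -- The retraction of G onto remove v G sends the leaf v to its neighbour.
  RetractsTo : ∀ x i → Set
  RetractsTo x i = x ≡ punchIn v i ⊎ (x ≡ v × i ≡ w)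

  unique : ∀ {x i j} → RetractsTo x i → RetractsTo x j → i ≡ j
  unique (inj₁ p)            (inj₁ q)            = Fin.punchIn-injective v _ _ (≡.trans (≡.sym p) q)
  unique (inj₁ p)            (inj₂ (q , _))      = contradiction (≡.trans (≡.sym p) q) (Fin.punchInᵢ≢i v _)
  unique (inj₂ (p , _))      (inj₁ q)            = contradiction (≡.trans (≡.sym q) p) (Fin.punchInᵢ≢i v _)
  unique (inj₂ (_ , ≡.refl)) (inj₂ (_ , ≡.refl)) = ≡.refl

  retract : ∀ {x y i j} → RetractsTo x i → RetractsTo y j → Star Adj x y → Star (Graph.Adj (remove v G)) i j
  retract p q Star.ε with unique p q
  ... | ≡.refl = Star.ε
  retract {x} {y} {i} {j} p q (_◅_ {j = z} x~z walk) with punchIn-split v z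
  -- A step into the leaf comes from its neighbour, which has the same image, so the retracted walk
  -- stands still.
  retract {x} {y} {i} {j} p q (x~z ◅ walk) | inj₁ ≡.refl
    with unique p (inj₁ (only′ x x~z))
  ... | ≡.refl = retract (inj₂ (≡.refl , ≡.refl)) q walk
  retract {x} {y} {i} {j} (inj₁ ≡.refl) q (x~z ◅ walk) | inj₂ (k , ≡.refl) = x~z ◅ retract (inj₁ ≡.refl) q walk
  retract {x} {y} {i} {j} (inj₂ (≡.refl , ≡.refl)) q (x~z ◅ walk) | inj₂ (k , ≡.refl)
    with Fin.punchIn-injective v k w (only _ x~z)
  ... | ≡.refl = retract (inj₁ ≡.refl) q walk

insert : ∀ {n} → Fin (suc n) → _ → Subset n → Subset (suc n)
insert v b X = Vec.insertAt X v b

-- A view: matching on it splits a subset into its membership at `v` and its restriction to the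
-- other vertices.
data Insertion {n} (v : Fin (suc n)) : Subset (suc n) → Set where
  inserted : ∀ b X → Insertion v (insert v b X)

insertion : ∀ {n} (v : Fin (suc n)) X → Insertion v X
insertion v X = ≡.subst (Insertion v) (Vec.insertAt-removeAt X v) (inserted (Vec.lookup X v) (Vec.removeAt X v))

∈-insert⁺ : ∀ {n} {v : Fin (suc n)} {b X i} → i ∈ X → punchIn v i ∈ insert v b X
∈-insert⁺ {v = v} {b} {X} {i} i∈X =
  Vec.lookup⇒[]= (punchIn v i) (insert v b X) (≡.trans (Vec.insertAt-punchIn X v b i) (Vec.[]=⇒lookup i∈X))

∈-insert⁻ : ∀ {n} {v : Fin (suc n)} {b X i} → punchIn v i ∈ insert v b X → i ∈ X
∈-insert⁻ {v = v} {b} {X} {i} h =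
  Vec.lookup⇒[]= i X (≡.trans (≡.sym (Vec.insertAt-punchIn X v b i)) (Vec.[]=⇒lookup h))

v∈-insert : ∀ {n} {v : Fin (suc n)} X → v ∈ insert v inside X
v∈-insert {v = v} X = Vec.lookup⇒[]= v (insert v inside X) (Vec.insertAt-lookup X v inside)

v∉-insert : ∀ {n} {v : Fin (suc n)} X → ¬ (v ∈ insert v outside X)
v∉-insert {v = v} X h with ≡.trans (≡.sym (Vec.insertAt-lookup X v outside)) (Vec.[]=⇒lookup h)
... | ()

∣insert-inside∣ : ∀ {n} (v : Fin (suc n)) X → ∣ insert v inside X ∣ ≡ suc ∣ X ∣
∣insert-inside∣ zero    X           = ≡.refl
∣insert-inside∣ (suc v) (true  Vec.∷ X) = ≡.cong suc (∣insert-inside∣ v X)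
∣insert-inside∣ (suc v) (false Vec.∷ X) = ∣insert-inside∣ v X

∣insert-outside∣ : ∀ {n} (v : Fin (suc n)) X → ∣ insert v outside X ∣ ≡ ∣ X ∣
∣insert-outside∣ zero    X           = ≡.refl
∣insert-outside∣ (suc v) (true  Vec.∷ X) = ≡.cong suc (∣insert-outside∣ v X)
∣insert-outside∣ (suc v) (false Vec.∷ X) = ∣insert-outside∣ v X

∣X∣≤∣insert∣ : ∀ {n} (v : Fin (suc n)) b X → ∣ X ∣ ℕ.≤ ∣ insert v b X ∣
∣X∣≤∣insert∣ v true  X = ℕ.≤-trans (ℕ.n≤1+n _) (ℕ.≤-reflexive (≡.sym (∣insert-inside∣ v X)))
∣X∣≤∣insert∣ v false X = ℕ.≤-reflexive (≡.sym (∣insert-outside∣ v X))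

cover-remove : ∀ {n} (G : Graph (suc n)) v {b X} → IsVertexCover G (insert v b X) → IsVertexCover (remove v G) X
cover-remove G v cover i j i~j = Sum.map ∈-insert⁻ ∈-insert⁻ (cover (punchIn v i) (punchIn v j) i~j)

isolated-cover : ∀ {n} (G : Graph (suc n)) v {X} → Isolated G v → IsVertexCover (remove v G) X →
  IsVertexCover G (insert v outside X)
isolated-cover G v isolated cover i j i~j with punchIn-split v i | punchIn-split v j
... | inj₁ ≡.refl       | _                 = contradiction i~j (isolated j)
... | inj₂ _            | inj₁ ≡.refl       = contradiction (Graph.adj-sym G i~j) (isolated i)
... | inj₂ (k , ≡.refl) | inj₂ (l , ≡.refl) = Sum.map ∈-insert⁺ ∈-insert⁺ (cover k l i~j)

-- The neighbour `w` covers its own edges, and the only edge at `v` is one of them; so `v` can stay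
-- outside.
leaf-cover : ∀ {n} (G : Graph (suc (suc n))) v w {X} → LeafAt G v (punchIn v w) →
  IsVertexCover (remove w (remove v G)) X → IsVertexCover G (insert v outside (insert w inside X))
leaf-cover G v w {X} leaf cover i j i~j with punchIn-split v i | punchIn-split v j
... | inj₁ ≡.refl       | _                 =
  inj₂ (≡.subst (_∈ _) (≡.sym (LeafAt.only leaf j i~j)) (∈-insert⁺ (v∈-insert X)))
... | inj₂ _            | inj₁ ≡.refl       =
  inj₁ (≡.subst (_∈ _) (≡.sym (LeafAt.only′ leaf i i~j)) (∈-insert⁺ (v∈-insert X)))
... | inj₂ (k , ≡.refl) | inj₂ (l , ≡.refl) with punchIn-split w k | punchIn-split w l
...   | inj₁ ≡.refl       | _                 = inj₁ (∈-insert⁺ (v∈-insert X))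
...   | inj₂ _            | inj₁ ≡.refl       = inj₂ (∈-insert⁺ (v∈-insert X))
...   | inj₂ (p , ≡.refl) | inj₂ (q , ≡.refl) =
  Sum.map (∈-insert⁺ ∘ ∈-insert⁺) (∈-insert⁺ ∘ ∈-insert⁺) (cover p q i~j)

-- One end of the edge lies in the cover, so at least one vertex is lost when both ends are deleted.
-- Together with `leaf-cover`, deleting a leaf and its neighbour lowers the vertex cover number by
-- exactly one.
edge-cover-size : ∀ {n} (G : Graph (suc (suc n))) v w {b c X} → Graph.Adj G v (punchIn v w) →
  IsVertexCover G (insert v b (insert w c X)) → suc ∣ X ∣ ℕ.≤ ∣ insert v b (insert w c X) ∣
edge-cover-size G v w {true}  {c}     {X} v~w cover =
  ℕ.≤-trans (s≤s (∣X∣≤∣insert∣ w c X)) (ℕ.≤-reflexive (≡.sym (∣insert-inside∣ v (insert w c X))))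
edge-cover-size G v w {false} {true}  {X} v~w cover =
  ℕ.≤-reflexive (≡.trans (≡.sym (∣insert-inside∣ w X)) (≡.sym (∣insert-outside∣ v (insert w true X))))
edge-cover-size G v w {false} {false} {X} v~w cover with cover v (punchIn v w) v~w
... | inj₁ v∈ = contradiction v∈ (v∉-insert (insert w false X))
... | inj₂ w∈ = contradiction (∈-insert⁻ w∈) (v∉-insert X)

-- The characteristic polynomial of a forest and its matching numbers

module Forests (O : OrderedRing) where

  open OrderedRing O
  open OrderedRings O using (ι-+)
  open Polynomials O
  open Determinants commutativeRing
  open IntegerCoefficients commutativeRing using (solve; _:=_; _:*_; _:-_; :-_; con)
  open import Algebra.Properties.Ring ring using (-0#≈0#; -‿+-comm)
  open import Relation.Binary.Reasoning.Setoid setoid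

  indicator : ∀ {n} → Fin n → Fin n → Carrier
  indicator i j = if does (i Fin.≟ j) then 1# else 0#

  adjacency : ∀ {n} → Graph n → Mat n
  adjacency G i j = if does (Graph.adj? G i j) then 1# else 0#

  characteristic : ∀ {n} → Graph n → Carrier → Mat n
  characteristic G x i j = x * indicator i j - adjacency G i j

  indicator-≡ : ∀ {n} (i : Fin n) → indicator i i ≡ 1#
  indicator-≡ i = ≡.cong (if_then 1# else 0#) (dec-true (i Fin.≟ i) ≡.refl)

  indicator-≢ : ∀ {n} {i j : Fin n} → i ≢ j → indicator i j ≡ 0#
  indicator-≢ {i = i} {j} i≢j = ≡.cong (if_then 1# else 0#) (dec-false (i Fin.≟ j) i≢j)

  indicator-punchIn : ∀ {n} (v : Fin (suc n)) i j → indicator (punchIn v i) (punchIn v j) ≡ indicator i j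
  indicator-punchIn v i j with i Fin.≟ j
  ... | yes ≡.refl = indicator-≡ (punchIn v i)
  ... | no  i≢j    = indicator-≢ (i≢j ∘ Fin.punchIn-injective v i j)

  module _ {n} (G : Graph n) (x : Carrier) where

    open Graph G

    adjacent≈1 : ∀ {i j} → Adj i j → adjacency G i j ≡ 1#
    adjacent≈1 {i} {j} i~j = ≡.cong (if_then 1# else 0#) (dec-true (adj? i j) i~j)

    nonadjacent≈0 : ∀ {i j} → ¬ Adj i j → adjacency G i j ≡ 0#
    nonadjacent≈0 {i} {j} i≁j = ≡.cong (if_then 1# else 0#) (dec-false (adj? i j) i≁j)

    characteristic-diagonal : ∀ i → characteristic G x i i ≈ x
    characteristic-diagonal i = begin
      x * indicator i i - adjacency G i i   ≈⟨ +-cong (*-congˡ (reflexive (indicator-≡ i)))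
                                                (-‿cong (reflexive (nonadjacent≈0 (adj-irrefl ≡.refl)))) ⟩
      x * 1# - 0#                           ≈⟨ +-cong (*-identityʳ x) -0#≈0# ⟩
      x + 0#                                ≈⟨ +-identityʳ x ⟩
      x                                     ∎

    characteristic-off-diagonal : ∀ {i j} → i ≢ j → characteristic G x i j ≈ - adjacency G i j
    characteristic-off-diagonal i≢j =
      trans (+-congʳ (trans (*-congˡ (reflexive (indicator-≢ i≢j))) (zeroʳ x))) (+-identityˡ _)

    characteristic-nonadjacent : ∀ {i j} → i ≢ j → ¬ Adj i j → characteristic G x i j ≈ 0#
    characteristic-nonadjacent i≢j i≁j =
      trans (characteristic-off-diagonal i≢j) (trans (-‿cong (reflexive (nonadjacent≈0 i≁j))) -0#≈0#)

    characteristic-adjacent : ∀ {i j} → Adj i j → characteristic G x i j ≈ - 1#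
    characteristic-adjacent i~j =
      trans (characteristic-off-diagonal λ i≡j → adj-irrefl i≡j i~j) (-‿cong (reflexive (adjacent≈1 i~j)))

  characteristic-remove : ∀ {n} (v : Fin (suc n)) (G : Graph (suc n)) x i j →
    minor v v (characteristic G x) i j ≈ characteristic (remove v G) x i j
  characteristic-remove v G x i j = +-congʳ (*-congˡ (reflexive (indicator-punchIn v i j)))

  det-remove : ∀ {n} (v : Fin (suc n)) (G : Graph (suc n)) x →
    Det (minor v v (characteristic G x)) ≈ Det (characteristic (remove v G) x)
  det-remove v G x = det-cong (characteristic-remove v G x)

  det-isolated-vertex : ∀ {n} (G : Graph (suc n)) v x → Isolated G v →
    Det (characteristic G x) ≈ x * Det (characteristic (remove v G) x)
  det-isolated-vertex G v x isolated = trans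
    (det-isolated v (characteristic G x)
      (λ j → characteristic-nonadjacent G x (Fin.punchInᵢ≢i v j ∘ ≡.sym) (isolated _)))
    (*-cong (characteristic-diagonal G x v) (det-remove v G x))

  det-leaf-vertex : ∀ {n} (G : Graph (suc (suc n))) v w x → LeafAt G v (punchIn v w) →
    Det (characteristic G x) ≈
      x * Det (characteristic (remove v G) x) - Det (characteristic (remove w (remove v G)) x)
  det-leaf-vertex G v w x leaf = begin
    Det M
      ≈⟨ det-leaf v w M
           (λ j → characteristic-nonadjacent G x (Fin.punchInᵢ≢i v _ ∘ ≡.sym) (not-w j ∘ only _))
           (λ i → characteristic-nonadjacent G x (Fin.punchInᵢ≢i v _) (not-w i ∘ only′ _)) ⟩
    M v v * Det (minor v v M) - (M v w′ * M w′ v) * Det (minor w w (minor v v M))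
      ≈⟨ +-cong (*-cong (characteristic-diagonal G x v) (det-remove v G x))
           (-‿cong (*-cong (*-cong (characteristic-adjacent G x adjacent) (characteristic-adjacent G x (adj-sym adjacent)))
             (trans (det-cong λ i j → characteristic-remove v G x (punchIn w i) (punchIn w j))
               (det-remove w (remove v G) x)))) ⟩
    x * D₁ - (- 1# * - 1#) * D₂
      ≈⟨ solve 3 (λ x d e → x :* d :- (:- con (+ 1) :* :- con (+ 1)) :* e := x :* d :- e) refl x D₁ D₂ ⟩
    x * D₁ - D₂ ∎
    where
    open Graph G
    open LeafAt leaf
    M  = characteristic G x
    w′ = punchIn v w
    D₁ = Det (characteristic (remove v G) x)
    D₂ = Det (characteristic (remove w (remove v G)) x)
    not-w : ∀ j → punchIn v (punchIn w j) ≢ punchIn v w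
    not-w j = Fin.punchInᵢ≢i w j ∘ Fin.punchIn-injective v _ _

  alternating-+ : ∀ a b j → alternating (λ k → a k ℕ.+ b k) j ≈ alternating a j + alternating b j
  alternating-+ a b zero          = ι-+ (a 0) (b 0)
  alternating-+ a b (suc zero)    = sym (+-identityˡ 0#)
  alternating-+ a b (suc (suc j)) = trans (-‿cong (alternating-+ (a ∘ suc) (b ∘ suc) j)) (sym (-‿+-comm _ _))

  -- matchings k stands for the number of matchings with k edges.
  record MatchingCounts {n} (G : Graph n) : Set where
    field
      matchings  : ℕ → ℕ
      expansion  : ∀ x → Det (characteristic G x) ≈ ev n (alternating matchings) x
      empty      : matchings 0 ≡ 1
      edges≤     : matchings 1 ℕ.≤ ℕ.pred n
      edges≥     : Connected G → n ℕ.≤ suc (matchings 1)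
      disjoint   : ∀ k → n ℕ.< k ℕ.+ k → matchings k ≡ 0
      covered    : ∀ X → IsVertexCover G X → ∀ k → ∣ X ∣ ℕ.< k → matchings k ≡ 0
      kőnig      : ∃[ X ] (IsVertexCover G X × 1 ℕ.≤ matchings ∣ X ∣)

  matchingCounts-empty : (G : Graph 0) → MatchingCounts G
  matchingCounts-empty G = record
    { matchings = λ { zero → 1 ; (suc k) → 0 }
    ; expansion = λ x → refl
    ; empty     = ≡.refl
    ; edges≤    = z≤n
    ; edges≥    = λ _ → z≤n
    ; disjoint  = λ { (suc k) _ → ≡.refl }
    ; covered   = λ { X _ (suc k) _ → ≡.refl }
    ; kőnig     = Vec.[] , (λ ()) , s≤s z≤n
    }

  -- Multiplication by x in `ev` appends a last coefficient, which has to be zero. It is, because a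
  -- matching that reaches that index would need more than `n` vertices.
  alternating-beyond : ∀ {n} m → (∀ k → n ℕ.< k ℕ.+ k → m k ≡ 0) → alternating m (suc n) ≈ 0#
  alternating-beyond {n} m m≡0 = alternating-≈0 m (suc n) λ k eq → m≡0 k (ℕ.≤-reflexive eq)

  matchingCounts-isolated : ∀ {n} (G : Graph (suc n)) v → Isolated G v → MatchingCounts (remove v G) → MatchingCounts G
  matchingCounts-isolated {n} G v isolated counts = record
    { matchings = matchings
    ; expansion = λ x → begin
        Det (characteristic G x)                      ≈⟨ det-isolated-vertex G v x isolated ⟩
        x * Det (characteristic (remove v G) x)       ≈⟨ *-congˡ (expansion x) ⟩
        x * ev n (alternating matchings) x            ≈⟨ +-identityʳ _ ⟨
        x * ev n (alternating matchings) x + 0#       ≈⟨ +-congˡ (alternating-beyond matchings disjoint) ⟨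
        ev (suc n) (alternating matchings) x          ∎
    ; empty     = empty
    ; edges≤    = ℕ.≤-trans edges≤ ℕ.pred[n]≤n
    ; edges≥    = λ connected → ≡.subst (λ k → suc k ℕ.≤ _) (≡.sym (isolated-connected G v isolated connected)) (s≤s z≤n)
    ; disjoint  = λ k n<k+k → disjoint k (ℕ.<-trans (ℕ.n<1+n n) n<k+k)
    ; covered   = covered-by
    ; kőnig     = let X , cover , 1≤m = kőnig in
        insert v outside X , isolated-cover G v isolated cover ,
        ≡.subst (λ k → 1 ℕ.≤ matchings k) (≡.sym (∣insert-outside∣ v X)) 1≤m
    }
    where
    open MatchingCounts counts
    covered-by : ∀ X → IsVertexCover G X → ∀ k → ∣ X ∣ ℕ.< k → matchings k ≡ 0
    covered-by X cover k ∣X∣<k with insertion v X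
    ... | inserted b Y = covered Y (cover-remove G v cover) k (ℕ.≤-<-trans (∣X∣≤∣insert∣ v b Y) ∣X∣<k)

  -- Matchings without the edge at the leaf are those of `remove v G`; the others arise from
  -- matchings of `remove w (remove v G)` by adding that edge. This gives the numbers `m`. The
  -- witness for `kőnig` comes from the second kind alone, where cover and matching both grow by
  -- one.
  matchingCounts-leaf : ∀ {n} (G : Graph (suc (suc n))) v w → LeafAt G v (punchIn v w) →
    MatchingCounts (remove v G) → MatchingCounts (remove w (remove v G)) → MatchingCounts G
  matchingCounts-leaf {n} G v w leaf counts₁ counts₂ = record
    { matchings = m
    ; expansion = λ x → begin
        Det (characteristic G x)
          ≈⟨ det-leaf-vertex G v w x leaf ⟩
        x * Det (characteristic (remove v G) x) - Det (characteristic (remove w (remove v G)) x)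
          ≈⟨ +-cong (*-congˡ (C₁.expansion x)) (-‿cong (C₂.expansion x)) ⟩
        x * ev (suc n) (alternating m₁) x - ev n (alternating m₂) x
          -- Both terms are brought to the same degree: a zero is appended to the first, two leading
          -- zeros are put before the second.
          ≈⟨ +-cong (trans (sym (+-identityʳ _)) (+-congˡ (sym (alternating-beyond m₁ C₁.disjoint))))
               (-‿cong (trans (sym (ev-tail n (delayed ∘ suc) x refl)) (sym (ev-tail (suc n) delayed x refl)))) ⟩
        ev (suc (suc n)) (alternating m₁) x - ev (suc (suc n)) delayed x
          ≈⟨ ev-- (suc (suc n)) (alternating m₁) delayed x ⟨
        ev (suc (suc n)) (λ j → alternating m₁ j - delayed j) x
          ≈⟨ ev-cong (suc (suc n)) split x ⟨
        ev (suc (suc n)) (alternating m) x ∎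
    ; empty     = C₁.empty
    -- The edge at the leaf is counted as `m₂ 0`, the empty matching of the rest; this is where the
    -- field `empty` enters.
    ; edges≤    = ℕ.≤-trans (ℕ.+-mono-≤ C₁.edges≤ (ℕ.≤-reflexive C₂.empty)) (ℕ.≤-reflexive (ℕ.+-comm n 1))
    ; edges≥    = λ connected → ℕ.≤-trans (s≤s (C₁.edges≥ (leaf-connected G v w leaf connected)))
        (ℕ.≤-reflexive (≡.cong suc (≡.trans (ℕ.+-comm 1 (m₁ 1)) (≡.cong (m₁ 1 ℕ.+_) (≡.sym C₂.empty)))))
    ; disjoint  = λ { (suc k) (s≤s n<) → ≡.cong₂ ℕ._+_
        (C₁.disjoint (suc k) (ℕ.<-trans n< (ℕ.n<1+n _)))
        (C₂.disjoint k (ℕ.s≤s⁻¹ (≡.subst (suc n ℕ.<_) (ℕ.+-suc k k) n<))) }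
    ; covered   = covered
    ; kőnig     = let X , cover , 1≤m = C₂.kőnig in
        insert v outside (insert w inside X) , leaf-cover G v w leaf cover ,
        ≡.subst (λ k → 1 ℕ.≤ m k) (≡.sym (≡.trans (∣insert-outside∣ v (insert w inside X)) (∣insert-inside∣ w X)))
          (ℕ.≤-trans 1≤m (ℕ.m≤n+m _ _))
    }
    where
    module C₁ = MatchingCounts counts₁
    module C₂ = MatchingCounts counts₂
    m₁ = C₁.matchings
    m₂ = C₂.matchings
    m : ℕ → ℕ
    m zero    = m₁ zero
    m (suc k) = m₁ (suc k) ℕ.+ m₂ k
    delayed : ℕ → Carrier
    delayed zero          = 0#
    delayed (suc zero)    = 0#
    delayed (suc (suc j)) = alternating m₂ j
    -- The minus sign of the recursion is the change of sign between matchings with `k` and with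
    -- `suc k` edges, so the counts add.
    split : ∀ j → alternating m j ≈ alternating m₁ j - delayed j
    split zero          = sym (trans (+-congˡ -0#≈0#) (+-identityʳ _))
    split (suc zero)    = sym (-‿inverseʳ 0#)
    split (suc (suc j)) = trans (-‿cong (alternating-+ (m₁ ∘ suc) m₂ j)) (sym (-‿+-comm _ _))
    covered : ∀ X → IsVertexCover G X → ∀ k → ∣ X ∣ ℕ.< k → m k ≡ 0
    covered X cover (suc k) ∣X∣<k with insertion v X
    ... | inserted b Y with insertion w Y
    ...   | inserted c Z = ≡.cong₂ ℕ._+_
      (C₁.covered (insert w c Z) cover₁ (suc k) (ℕ.≤-<-trans (∣X∣≤∣insert∣ v b (insert w c Z)) ∣X∣<k))
      (C₂.covered Z (cover-remove (remove v G) w cover₁) k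
        (ℕ.s≤s⁻¹ (ℕ.≤-<-trans (edge-cover-size G v w (LeafAt.adjacent leaf) cover) ∣X∣<k)))
      where
      cover₁ : IsVertexCover (remove v G) (insert w c Z)
      cover₁ = cover-remove G v cover

  matchingCounts : ∀ {n} (G : Graph n) → Acyclic G → MatchingCounts G
  matchingCounts {zero}  G acyclic = matchingCounts-empty G
  matchingCounts {suc n} G acyclic with isolated-or-leaf G acyclic
  ... | inj₁ (v , isolated)  =
    matchingCounts-isolated G v isolated (matchingCounts (remove v G) (remove-acyclic v G acyclic))
  ... | inj₂ (v , w , leaf) with punchIn-split v w
  ...   | inj₁ ≡.refl = contradiction (LeafAt.adjacent leaf) (Graph.adj-irrefl G ≡.refl)
  matchingCounts {suc (suc n)} G acyclic | inj₂ (v , w , leaf) | inj₂ (w′ , ≡.refl) =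
    matchingCounts-leaf G v w′ leaf
      (matchingCounts (remove v G) (remove-acyclic v G acyclic))
      (matchingCounts (remove w′ (remove v G)) (remove-acyclic w′ (remove v G) (remove-acyclic v G acyclic)))

tree₂≅complete : (G : Graph 2) → Connected G → G ≅ complete 2
tree₂≅complete G connected = ↔-id (Fin 2) , λ i j →
  mk⇔ (λ i~j i≡j → adj-irrefl i≡j i~j) (λ i≢j → adjacent i≢j (connected i j))
  where
  open Graph G
  other : ∀ {i j k : Fin 2} → i ≢ j → i ≢ k → j ≡ k
  other {zero}     {zero}     i≢j _   = contradiction ≡.refl i≢j
  other {zero}     {suc zero} {zero}     _ i≢k = contradiction ≡.refl i≢k
  other {zero}     {suc zero} {suc zero} _ _   = ≡.refl
  other {suc zero} {suc zero} i≢j _   = contradiction ≡.refl i≢j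
  other {suc zero} {zero}     {zero}     _ _   = ≡.refl
  other {suc zero} {zero}     {suc zero} _ i≢k = contradiction ≡.refl i≢k
  adjacent : ∀ {i j} → i ≢ j → Star Adj i j → Adj i j
  adjacent i≢j Star.ε           = contradiction ≡.refl i≢j
  adjacent {i} i≢j (i~k ◅ _) = ≡.subst (Adj i) (other (λ i≡k → adj-irrefl i≡k i~k) i≢j) i~k

-- The energy of a tree over an ordered ring

module TreeEnergy (O : OrderedRing) where

  open OrderedRing O
  open OrderedRings O
  open Polynomials O
  open Determinants commutativeRing
  open IntegerCoefficients commutativeRing using (ι)
  open Forests O

  module _ {n} (G : Graph n) (tree : IsTree G) (τ : ℕ) (number : IsVertexCoverNumber G τ)
    (M : List Carrier) (length≡n : length M ≡ n) (spectrum : ∀ x → Det (characteristic G x) ≈ Π (map (λ μ → x - μ) M))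
    where

    open IsTree tree
    open IsVertexCoverNumber number
    open MatchingCounts (matchingCounts G acyclic)

    0<matchings⇒k+k≤n : ∀ k → 1 ℕ.≤ matchings k → k ℕ.+ k ℕ.≤ n
    0<matchings⇒k+k≤n k 1≤m = ℕ.≮⇒≥ λ n<k+k → ℕ.<⇒≱ 1≤m (ℕ.≤-reflexive (disjoint k n<k+k))

    τ<k⇒matchings≡0 : ∀ k → τ ℕ.< k → matchings k ≡ 0
    τ<k⇒matchings≡0 k τ<k =
      let X , cover , ∣X∣≡τ = attained in covered X cover k (≡.subst (ℕ._< k) (≡.sym ∣X∣≡τ) τ<k)

    -- The cover supplied by `kőnig` is a smallest one: were it larger than τ, the matching number
    -- at its size would be zero.
    1≤matchings-τ : 1 ℕ.≤ matchings τ
    1≤matchings-τ =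
      let X , cover , 1≤m = kőnig
      in ≡.subst (λ k → 1 ℕ.≤ matchings k)
           (ℕ.≤-antisym (ℕ.≮⇒≥ λ τ<∣X∣ → ℕ.<⇒≱ 1≤m (ℕ.≤-reflexive (τ<k⇒matchings≡0 ∣ X ∣ τ<∣X∣))) (minimal X cover)) 1≤m

    τ+τ≤n : τ ℕ.+ τ ℕ.≤ n
    τ+τ≤n = 0<matchings⇒k+k≤n τ 1≤matchings-τ

    coefficients : ∀ j → j ℕ.≤ length M → esym M j ≈ alternating matchings j
    coefficients = ev-injective (length M) (esym M) (alternating matchings) λ x → trans (ev-esym M x)
      (trans (sym (spectrum x)) (trans (expansion x) (reflexive (≡.cong (λ k → ev k (alternating matchings) x) (≡.sym length≡n)))))

    τ+τ≤length : τ ℕ.+ τ ℕ.≤ length M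
    τ+τ≤length = ≡.subst (τ ℕ.+ τ ℕ.≤_) (≡.sym length≡n) τ+τ≤n

    tree-energy-≥ : ι (τ ℕ.+ τ) ≤ ∣Σ∣ M
    tree-energy-≥ = Spectrum.energy-≥ M matchings coefficients τ τ+τ≤length 1≤matchings-τ τ<k⇒matchings≡0

    -- `2 ≤ n` excludes the single vertex, for which the energy and 2τ are both zero, so that
    -- equality holds there as well.
    tree-energy-≡⇒ : 2 ℕ.≤ n → ∣Σ∣ M ≈ ι (τ ℕ.+ τ) → n ≡ 2
    tree-energy-≡⇒ 2≤n eq = ℕ.≤-antisym (ℕ.+-cancelʳ-≤ n n 2 (begin
      n ℕ.+ n                                    ≤⟨ ℕ.+-mono-≤ (edges≥ connected) (edges≥ connected) ⟩
      suc (matchings 1) ℕ.+ suc (matchings 1)    ≡⟨ ≡.cong suc (ℕ.+-suc (matchings 1) (matchings 1)) ⟩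
      2 ℕ.+ (matchings 1 ℕ.+ matchings 1)
        ≤⟨ ℕ.+-monoʳ-≤ 2 (Spectrum.energy-≡ M matchings coefficients τ τ+τ≤length 1≤matchings-τ τ<k⇒matchings≡0
             (≡.subst (2 ℕ.≤_) (≡.sym length≡n) 2≤n) eq) ⟩
      2 ℕ.+ (τ ℕ.+ τ)                            ≤⟨ ℕ.+-monoʳ-≤ 2 τ+τ≤n ⟩
      2 ℕ.+ n                                    ∎)) 2≤n
      where open ℕ.≤-Reasoning

    τ≡1 : n ≡ 2 → τ ≡ 1
    τ≡1 ≡.refl = ℕ.≤-antisym
      (ℕ.≮⇒≥ λ 1<τ → ℕ.<⇒≱ (ℕ.≤-trans (s≤s (s≤s (s≤s z≤n))) (ℕ.+-mono-≤ 1<τ 1<τ)) τ+τ≤n)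
      (ℕ.≮⇒≥ λ τ<1 → ℕ.<⇒≱ (ℕ.s≤s⁻¹ (edges≥ connected)) (ℕ.≤-reflexive (τ<k⇒matchings≡0 1 τ<1)))

    tree-energy-≡⇐ : n ≡ 2 → ∣Σ∣ M ≈ ι (τ ℕ.+ τ)
    tree-energy-≡⇐ n≡2 = trans (≤-antisym (upper M (≡.trans length≡n n≡2) coefficients lower) lower)
      (reflexive (≡.cong (λ k → ι (k ℕ.+ k)) (≡.sym (τ≡1 n≡2))))
      where
      lower : ι 2 ≤ ∣Σ∣ M
      lower = ≡.subst (λ k → ι (k ℕ.+ k) ≤ ∣Σ∣ M) (τ≡1 n≡2) tree-energy-≥
      upper : ∀ L → length L ≡ 2 → (∀ j → j ℕ.≤ length L → esym L j ≈ alternating matchings j) →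
        ι 2 ≤ ∣Σ∣ L → ∣Σ∣ L ≤ ι 2
      upper (_ ∷ _ ∷ []) _ h = ∣Σ∣≤2 matchings h (≡.subst (λ k → matchings 1 ℕ.≤ ℕ.pred k) n≡2 edges≤)

    tree-energy-≡⇔ : 2 ℕ.≤ n → ∣Σ∣ M ≈ ι (τ ℕ.+ τ) ⇔ n ≡ 2
    tree-energy-≡⇔ 2≤n = mk⇔ (tree-energy-≡⇒ 2≤n) tree-energy-≡⇐

  Π-tabulate : ∀ {n} (μ : Vector Carrier n) x → ∏ rawRing (λ i → x - μ i) ≡ Π (map (λ y → x - y) (tabulate μ))
  Π-tabulate {zero}  μ x = ≡.refl
  Π-tabulate {suc n} μ x = ≡.cong (λ y → (x - μ zero) * y) (Π-tabulate (μ ∘ suc) x)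

  ∣Σ∣-tabulate : ∀ {n} (μ : Vector Carrier n) → ∑ rawRing (λ i → abs (μ i)) ≡ ∣Σ∣ (tabulate μ)
  ∣Σ∣-tabulate {zero}  μ = ≡.refl
  ∣Σ∣-tabulate {suc n} μ = ≡.cong (λ y → abs (μ zero) + y) (∣Σ∣-tabulate (μ ∘ suc))

-- The operations, the matrices I and A and the embedding ι of ℕ are parameters because Agda, when it compares
-- terms of type ℝ that differ syntactically, unfolds them down to the proofs of the Cauchy property.
module UnbundledTreeEnergy
  {C : Set} {_≈_ _≤_ : C → C → Set} {_+_ _*_ : C → C → C} { -_ abs : C → C} {0# 1# : C}
  (isOrderedRing : IsOrderedRing _≈_ _≤_ _+_ _*_ -_ abs 0# 1#)
  where

  O : OrderedRing
  O = record { isOrderedRing = isOrderedRing }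

  open OrderedRing O using (rawRing; commutativeRing; sym; trans; reflexive; +-cong; -‿cong; *-congˡ; ≤-trans; ≤-reflexive)
  open TreeEnergy O
  open Determinants commutativeRing using (det-cong)
  module I = IntegerCoefficients commutativeRing

  tree-energy : ∀ {n} (G : Graph n) → IsTree G → ∀ τ → IsVertexCoverNumber G τ →
    (I A : Fin n → Fin n → C) →
    (∀ i j → I i j ≡ (if does (i Fin.≟ j) then 1# else 0#)) →
    (∀ i j → A i j ≡ (if does (Graph.adj? G i j) then 1# else 0#)) →
    (μ : Vector C n) → (∀ x → det rawRing (λ i j → (x * I i j) + (- A i j)) ≈ ∏ rawRing (λ i → x + (- μ i))) →
    (ι : ℕ → C) → ι 0 ≈ 0# → (∀ k → ι (suc k) ≈ (1# + ι k)) →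
    ∀ E → E ≈ ∑ rawRing (λ i → abs (μ i)) →
    (ι (2 ℕ.* τ) ≤ E) × (2 ℕ.≤ n → (E ≈ ι (2 ℕ.* τ)) ⇔ (n ≡ 2))
  tree-energy {n} G tree τ number I A I≡ A≡ μ spectrum ι ι-0 ι-suc E E≈ =
    ≤-trans (≤-reflexive ι≈) (≤-trans (tree-energy-≥ G tree τ number M length≡n spectrum′) (≤-reflexive (sym E≈∣Σ∣))) ,
    λ 2≤n → let module ⇔ = Equivalence (tree-energy-≡⇔ G tree τ number M length≡n spectrum′ 2≤n) in
      mk⇔ (λ eq → ⇔.to (trans (sym E≈∣Σ∣) (trans eq ι≈))) (λ n≡2 → trans E≈∣Σ∣ (trans (⇔.from n≡2) (sym ι≈)))
    where
    M = tabulate μ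
    length≡n : length M ≡ n
    length≡n = length-tabulate μ
    spectrum′ : ∀ x → det rawRing (Forests.characteristic O G x) ≈ OrderedRings.Π O (map (λ y → x + (- y)) M)
    spectrum′ x = trans (det-cong λ i j → sym (+-cong (*-congˡ (reflexive (I≡ i j))) (-‿cong (reflexive (A≡ i j)))))
      (trans (spectrum x) (reflexive (Π-tabulate μ x)))
    E≈∣Σ∣ : E ≈ OrderedRings.∣Σ∣ O M
    E≈∣Σ∣ = trans E≈ (reflexive (∣Σ∣-tabulate μ))
    ι≈ : ι (2 ℕ.* τ) ≈ I.ι (τ ℕ.+ τ)
    ι≈ = trans (I.ι-unique ι ι-0 ι-suc (2 ℕ.* τ)) (reflexive (≡.cong (λ k → I.ι (τ ℕ.+ k)) (ℕ.+-identityʳ τ)))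

-- Specialisation to the Cauchy reals

module RealTreeEnergy where

  open import Defs
  open Reals
  open Rationals

  1≰0 : ¬ (1ℝ ≤ 0ℝ)
  1≰0 = apart {1ℝ} {0ℝ} {1ℚ} (ℚ.positive⁻¹ 1ℚ) (0 , λ _ _ → ℚ.≤-refl)

  ℝ-isOrderedRing : IsOrderedRing _≈_ _≤_ _+_ _*_ -_ abs 0ℝ 1ℝ
  ℝ-isOrderedRing = record
    { isCommutativeRing = ℝ-isCommutativeRing
    ; ≤-reflexive = ≤-reflexive
    ; ≤-trans = ≤-trans
    ; ≤-antisym = ≤-antisym
    ; ≤-stable = ≤-stable
    ; ≤-total = ≤-total
    ; +-mono-≤ = +-mono-≤
    ; *-nonNeg = *-nonNeg
    ; *-cancel = *-cancel
    ; 1≰0 = 1≰0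
    ; half = fromℚ ½
    ; half+half = pointwise λ _ → ≡.refl
    ; abs-cong = abs-cong
    ; abs-0 = pointwise λ _ → ≡.refl
    ; abs-neg = λ x → pointwise λ n → ℚ.∣-p∣≡∣p∣ (seq x n)
    ; abs-* = abs-*
    ; abs*abs = λ x → pointwise λ n → ∣p∣*∣p∣≡p*p (seq x n)
    ; 0≤abs = 0≤abs
    ; 0≤⇒abs≈ = 0≤⇒abs≈
    }

  -- Fractions in `ℚ` are reduced by a gcd that does not compute for a variable `n`; the equation is
  -- checked on unnormalised fractions, where it is polynomial.
  suc/1 : ∀ n → + suc n ℚ./ 1 ≡ 1ℚ ℚ.+ + n ℚ./ 1
  suc/1 n = ℚ.toℚᵘ-injective (begin
    ℚ.toℚᵘ (+ suc n ℚ./ 1)                 ≈⟨ ℚ.toℚᵘ-fromℚᵘ (mkℚᵘ (+ suc n) 0) ⟩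
    mkℚᵘ (+ suc n) 0                       ≈⟨ *≡* (solve 1 (λ n → (con (+ 1) :+ n) :* con (+ 1) :=
                                                (con (+ 1) :* con (+ 1) :+ n :* con (+ 1)) :* con (+ 1)) ≡.refl (+ n)) ⟩
    ℚ.toℚᵘ 1ℚ ℚᵘ.+ mkℚᵘ (+ n) 0            ≈⟨ ℚᵘ.+-congʳ (ℚ.toℚᵘ 1ℚ) (ℚ.toℚᵘ-fromℚᵘ (mkℚᵘ (+ n) 0)) ⟨
    ℚ.toℚᵘ 1ℚ ℚᵘ.+ ℚ.toℚᵘ (+ n ℚ./ 1)      ≈⟨ ℚ.toℚᵘ-homo-+ 1ℚ (+ n ℚ./ 1) ⟨
    ℚ.toℚᵘ (1ℚ ℚ.+ + n ℚ./ 1)              ∎)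
    where
    open ℚᵘ.≃-Reasoning
    open ℤ-Solver

  fromℕ-suc : ∀ n → fromℕ (suc n) ≈ 1ℝ + fromℕ n
  fromℕ-suc n = pointwise {fromℕ (suc n)} {1ℝ + fromℕ n} λ _ → suc/1 n

  energy : ∀ {n} (G : Graph n) → IsTree G → ∀ τ → IsVertexCoverNumber G τ → ∀ E → IsEnergy G E →
    (fromℕ (2 ℕ.* τ) ≤ E) × (2 ℕ.≤ n → E ≈ fromℕ (2 ℕ.* τ) ⇔ n ≡ 2)
  energy G tree τ number E (μ , spectrum , E≈∑) =
    UnbundledTreeEnergy.tree-energy ℝ-isOrderedRing G tree τ number identity (adjacencyMatrix G)
      (λ _ _ → ≡.refl) (λ _ _ → ≡.refl) μ spectrum fromℕ (pointwise λ _ → ≡.refl) fromℕ-suc E E≈∑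

open import Defs

theorem3p1 : ∀ {n : ℕ} (G : Graph n) → IsTree G →
    ∀ (τ : ℕ) → IsVertexCoverNumber G τ →
    ∀ (E : ℝ) → IsEnergy G E →
    (fromℕ (2 ℕ.* τ) ≤ E) × (2 ℕ.≤ n → (E ≈ fromℕ (2 ℕ.* τ) ⇔ G ≅ complete 2))
theorem3p1 G tree τ number E isEnergy =
  let bound , equality = RealTreeEnergy.energy G tree τ number E isEnergy
  in bound , λ 2≤n → let module ⇔ = Equivalence (equality 2≤n) in
    mk⇔ (λ eq → order-2 G tree (⇔.to eq)) (λ (f , _) → ⇔.from (↔⇒≡ f))
  where
  order-2 : ∀ {n} (G : Graph n) → IsTree G → n ≡ 2 → G ≅ complete 2
  order-2 G tree ≡.refl = tree₂≅complete G (IsTree.connected tree)
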